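{- Let $q=4k+1$ be a prime power with $k$ odd, let $\alpha$ be a primitive element of the finite field $\mathbb{F}_q$, and let $D^4_i=\{\alpha^{i+4j}:0\le j\le k-1\}$ for $0\le i\le 3$. Let $\mathcal{S}=\{S_1,S_2,S_3\}$ be the family of disjoint subsets of $\mathbb{Z}_2\times\mathbb{F}_q$ given by $$S_1=\{(0,0),(1,0)\},\quad S_2=(\{0\}\times D^4_0)\cup(\{1\}\times D^4_2),\quad S_3=(\{0\}\times D^4_1)\cup(\{0\}\times D^4_3).$$ Then $\mathcal{S}$ is an optimal $(n=2q,\ m=3,\ (2,2k,2k),\ a=4k+2,\ \lambda=2k+1)$-BSWEDF.
   Context: The group is the additive group $\mathbb{Z}_2\times\mathbb{F}_q$. For multi-sets $B_1,B_2$ of elements of an Abelian group $G$ of order $n$, $D(B_1,B_2)$ is the multi-set $\{x-y : x\in B_1,\ y\in B_2\}$; $k\boxtimes B$ is the multi-set in which each element of $B$ is repeated $k$ times; unions are multi-set unions. Let $\mathcal{B}=\{B_i : 1\le i\le m\}$ be a family of pairwise disjoint nonempty subsets of $G$, $k_i=|B_i|$, $K=(k_1,\dots,k_m)$, $a=\sum_i k_i$, $\widetilde{k}=\mathrm{lcm}(k_1,\dots,k_m)$, $\widetilde{B}_i=\frac{\widetilde{k}}{k_i}\boxtimes B_i$. Then $\mathcal{B}$ is an $(n,m,K,a,\lambda)$-BSWEDF (bounded standard weighted external difference family) if $\lambda$ is the smallest positive integer such that $\bigcup_{1\le i\ne j\le m}D(B_i,\widetilde{B}_j)\subseteq\lambda\boxtimes(G\setminus\{0\})$.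 It is optimal if $\lambda$ takes the smallest possible value among all BSWEDFs (over Abelian groups of order $n$) with the given $n,m,K$. -}

module Defs where

open import Algebra.Bundles using (AbelianGroup; CommutativeRing; Semiring)
open import Algebra.Construct.DirectProduct using (abelianGroup)
import Algebra.Definitions.RawSemiring as RawSemiringDefs
open import Data.Fin.Base using (Fin)
import Data.Fin.Properties as Fin
open import Data.List.Base
  using (List; []; _∷_; _++_; map; concatMap; replicate; length; filter; sum;
         upTo; allFin; tabulate; cartesianProduct; cartesianProductWith)
import Data.List.Relation.Binary.Disjoint.Setoid as Disjointness
import Data.List.Relation.Unary.Unique.Setoid as Uniqueness
open import Data.Nat.Base using (ℕ; suc; _+_; _*_; _^_; _≤_; _/_; NonZero)
open import Data.Nat.LCM using (lcm)
open import Data.Nat.Primality using (Prime)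
open import Data.Parity.Base using (Parity; 0ℙ; 1ℙ)
open import Data.Parity.Properties using (+-0-abelianGroup)
open import Data.Product.Base using (∃; ∃-syntax; _×_; _,_)
import Data.Vec.Functional as Vector
open Vector using (Vector)
open import Function.Base using (_∘_)
open import Function.Bundles using (Inverse)
open import Function.Properties.Inverse using (Inverse⇒Injection)
open import Level using (Level; _⊔_; Setω)
open import Relation.Binary.Bundles using (Setoid)
open import Relation.Binary.Definitions using (Decidable)
open import Relation.Binary.PropositionalEquality.Core using (_≡_)
open import Relation.Binary.PropositionalEquality.Properties using (setoid)
open import Relation.Nullary.Decidable using (¬?)
open import Relation.Nullary.Negation using (¬_)

private
  variable
    c ℓ : Level

PrimePower : ℕ → Set
PrimePower q = ∃[ p ] ∃[ e ] (Prime p × q ≡ p ^ suc e)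

HasOrder : Setoid c ℓ → ℕ → Set (c ⊔ ℓ)
HasOrder S n = Inverse S (setoid (Fin n))

record IsFieldOfOrder (F : CommutativeRing c ℓ) (q : ℕ) : Set (c ⊔ ℓ) where
  open CommutativeRing F using (Carrier; _≈_; 0#; 1#) renaming (_*_ to _·_; setoid to F-setoid)
  field
    1≉0   : ¬ (1# ≈ 0#)
    inv   : ∀ x → ¬ (x ≈ 0#) → ∃ λ y → (x · y) ≈ 1#
    order : HasOrder F-setoid q

infixr 7 _⊠_

-- Multisets are lists; only the multiplicities of their elements matter.
_⊠_ : {A : Set c} → ℕ → List A → List A
k ⊠ xs = concatMap (replicate k) xs

module Differences (G : AbelianGroup c ℓ) where
  open AbelianGroup G using (Carrier; _-_)

  D : List Carrier → List Carrier → List Carrier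
  D = cartesianProductWith _-_

  sizes : ∀ {m} → Vector (List Carrier) m → Vector ℕ m
  sizes B = length ∘ B

  weighted : ∀ {m} (B : Vector (List Carrier) m) → .(∀ i → NonZero (sizes B i)) →
             Vector (List Carrier) m
  weighted B nonEmpty i =
    (Vector.foldr lcm 1 (sizes B) / sizes B i) {{nonEmpty i}} ⊠ B i

  externalDifferences : ∀ {m} (B : Vector (List Carrier) m) →
                        .(∀ i → NonZero (sizes B i)) → List Carrier
  externalDifferences {m} B nonEmpty =
    concatMap (λ (i , j) → D (B i) (weighted B nonEmpty j))
      (filter (λ (i , j) → ¬? (i Fin.≟ j)) (cartesianProduct (allFin m) (allFin m)))

-- The enumeration of G supplies decidable equality and the list of nonzero
-- elements; neither multiplicities nor inclusions depend on its choice.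
module FiniteGroup (G : AbelianGroup c ℓ) {n : ℕ}
                   (order : HasOrder (AbelianGroup.setoid G) n) where
  open AbelianGroup G using (Carrier; _≈_; ε)

  _≟_ : Decidable _≈_
  _≟_ = Fin.inj⇒≟ (Inverse⇒Injection order)

  G∖0 : List Carrier
  G∖0 = filter (λ x → ¬? (x ≟ ε)) (map (Inverse.from order) (allFin n))

  multiplicity : Carrier → List Carrier → ℕ
  multiplicity x xs = length (filter (x ≟_) xs)

  infix 4 _⊆ᵐ_

  _⊆ᵐ_ : List Carrier → List Carrier → Set _
  xs ⊆ᵐ ys = ∀ x → multiplicity x xs ≤ multiplicity x ys

-- A subset of G is given as a list without repetitions.
record IsBSWEDF (G : AbelianGroup c ℓ) (n m : ℕ) (K : Vector ℕ m) (a l : ℕ)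
                (B : Vector (List (AbelianGroup.Carrier G)) m) : Set (c ⊔ ℓ) where
  open AbelianGroup G using () renaming (setoid to G-setoid)
  open Differences G
  open Uniqueness G-setoid using (Unique)
  open Disjointness G-setoid using (Disjoint)
  field
    order    : HasOrder G-setoid n
    unique   : ∀ i → Unique (B i)
    disjoint : ∀ i j → ¬ (i ≡ j) → Disjoint (B i) (B j)
    nonEmpty : ∀ i → NonZero (sizes B i)
    size     : ∀ i → sizes B i ≡ K i
    total    : a ≡ sum (tabulate K)

  open FiniteGroup G order

  Bound : ℕ → Set c
  Bound μ = externalDifferences B nonEmpty ⊆ᵐ μ ⊠ G∖0

  field
    positive : NonZero l
    bound    : Bound l
    smallest : ∀ μ → NonZero μ → Bound μ → l ≤ μ

record IsOptimalBSWEDF (G : AbelianGroup c ℓ) (n m : ℕ) (K : Vector ℕ m) (a l : ℕ)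
                       (B : Vector (List (AbelianGroup.Carrier G)) m) : Setω where
  field
    isBSWEDF : IsBSWEDF G n m K a l B
    optimal  : ∀ {c′ ℓ′} (H : AbelianGroup c′ ℓ′) (a′ l′ : ℕ)
               (C : Vector (List (AbelianGroup.Carrier H)) m) →
               IsBSWEDF H n m K a′ l′ C → l ≤ l′

module Construction (F : CommutativeRing c ℓ) where
  open CommutativeRing F using (Carrier; _≈_; 0#; semiring; +-abelianGroup)
  open RawSemiringDefs (Semiring.rawSemiring semiring) using () renaming (_^_ to _^ᶠ_)

  IsPrimitive : Carrier → Set (c ⊔ ℓ)
  IsPrimitive α = ¬ (α ≈ 0#) × (∀ x → ¬ (x ≈ 0#) → ∃ λ i → x ≈ α ^ᶠ i)

  -- The additive group of Parity is ℤ₂.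
  ℤ₂×F : AbelianGroup c ℓ
  ℤ₂×F = abelianGroup +-0-abelianGroup +-abelianGroup

  D⁴ : Carrier → ℕ → ℕ → List Carrier
  D⁴ α k i = map (λ j → α ^ᶠ (i + 4 * j)) (upTo k)

  infixr 6 [_]×_

  [_]×_ : Parity → List Carrier → List (Parity × Carrier)
  [ s ]× xs = map (s ,_) xs

  S : Carrier → ℕ → Vector (List (Parity × Carrier)) 3
  S α k = ((0ℙ , 0#) ∷ (1ℙ , 0#) ∷ [])
    Vector.∷ (([ 0ℙ ]× D⁴ α k 0) ++ ([ 1ℙ ]× D⁴ α k 2))
    Vector.∷ (([ 0ℙ ]× D⁴ α k 1) ++ ([ 0ℙ ]× D⁴ α k 3))
    Vector.∷ Vector.[]

{-# OPTIONS --safe #-}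
-- Lower bound: the external differences number 2k(8k + 4), which exceeds 2k times
-- the 8k + 1 nonzero elements of the group, so any bound λ is at least 2k + 1.
--
-- Upper bound: let t ≠ 0. The differences with S₁ contribute 1 + k to the multiplicity
-- of (s, t). As −1 = α²ᵏ lies in D⁴₂, the differences between S₂ and S₃ contribute,
-- for either s, the number T(t) of ways of writing t as a difference x − y with x in
-- D⁴₀ ∪ D⁴₂ and y in D⁴₁ ∪ D⁴₃. Multiplication by α and −1 ∈ D⁴₂ give T(αt) = T(t), so T
-- is constant on F*, and 4k · T ≤ (2k)² forces T ≤ k.
module Submission where

open import Defs
open import Algebra.Bundles using (AbelianGroup; CommutativeRing)
import Algebra.Properties.AbelianGroup as AbelianGroupₚ
import Algebra.Properties.Ring as Ringₚ
import Algebra.Properties.Semiring.Exp as Exp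
open import Data.Bool.Base using (if_then_else_)
open import Data.Fin.Base using (Fin; zero; suc; toℕ; fromℕ<)
open import Data.Fin.Patterns using (0F; 1F; 2F)
open import Data.Fin.Properties using (*↔×; pigeonhole; injective⇒≤; toℕ<n)
import Data.Fin.Properties as Fin
open import Data.List.Base as List
  using (List; _++_; map; replicate; length; filter; allFin; upTo; applyUpTo;
         cartesianProductWith)
open import Data.List.Properties
  using (map-cong; map-++; map-∘; map-upTo; length-map; length-++; length-upTo; length-tabulate;
         upTo-∷ʳ; filter-notAll; filter-some)
import Data.List.Membership.Setoid as Membership
import Data.List.Membership.Setoid.Properties as Membershipₚ
open import Data.List.Membership.Propositional.Properties using (∈-allFin)
import Data.List.Relation.Binary.Disjoint.Setoid as Disjointness
open import Data.List.Relation.Unary.All as All using (All)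
import Data.List.Relation.Unary.AllPairs as AllPairs
import Data.List.Relation.Unary.Any as Any
import Data.List.Relation.Unary.Any.Properties as Anyₚ
import Data.List.Relation.Unary.Unique.Setoid as Uniqueness
import Data.List.Relation.Unary.Unique.Setoid.Properties as Uniquenessₚ
open import Data.Nat.Base
  using (ℕ; zero; suc; _+_; _*_; _∸_; _/_; _%_; _≤_; _<_; z≤n; s≤s; NonZero; >-nonZero; >-nonZero⁻¹)
open import Data.Nat.Divisibility using (_∣_; divides; ∣-refl; ∣-trans; ∣-antisym; m∣m*n; 1∣_)
open import Data.Nat.DivMod using (m*n/n≡m; m%n<n; m≡m%n+[m/n]*n; [m+kn]%n≡m%n; m<n⇒m%n≡m)
open import Data.Nat.LCM using (lcm; lcm-least; m∣lcm[m,n]; n∣lcm[m,n])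
open import Data.Nat.ListAction using (sum)
open import Data.Nat.ListAction.Properties using (sum-++)
open import Data.Nat.Properties as ℕ
  hiding (_≟_; *-identityˡ; *-identityʳ; *-assoc; *-comm; +-comm; +-identityʳ)
open import Data.Nat.Solver using (module +-*-Solver)
open import Data.Parity.Base using (Parity; 0ℙ; 1ℙ) renaming (_+_ to _+ℙ_)
import Data.Parity.Properties as ℙ
open import Data.Product.Base using (_×_; _,_; proj₁; proj₂; ∃)
open import Data.Product.Function.NonDependent.Setoid using (_×-inverse_)
open import Data.Product.Relation.Binary.Pointwise.NonDependent using (Pointwise-≡↔≡)
open import Data.Sum.Base using ([_,_]′; inj₁; inj₂)
open import Data.Vec.Functional using (_∷_; [])
open import Data.Vec.Functional as Vector using (Vector)
open import Function.Base using (_∘_; id)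
open import Function.Bundles using (Injection; Inverse; _↔_; mk↔ₛ′)
open import Function.Construct.Composition using (inverse)
open import Function.Construct.Symmetry using () renaming (inverse to inverse-sym)
open import Function.Properties.Inverse using (Inverse⇒Injection)
open import Level using (Level)
open import Relation.Binary.Definitions using (tri<; tri≈; tri>)
open import Relation.Binary.PropositionalEquality as ≡
  using (_≡_; _≢_; refl; sym; trans; cong; cong₂; subst; subst₂; module ≡-Reasoning)
import Relation.Binary.Reasoning.Setoid as SetoidReasoning
open import Relation.Nullary.Decidable using (Dec; yes; no; does; ¬?)
open import Relation.Nullary.Negation using (¬_; contradiction)
import Relation.Unary as Unary

-- `IsPrimitive` says only that the powers of `α` exhaust the nonzero elements. That `α` has order
-- exactly 4k has to be derived: distinctness of the classes, their period 4 in the index and α²ᵏ =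
-- -1 all rest on it.
--
-- Oddness of k acts through 2k = 4h + 2: it places -1 in D⁴₂ rather than in D⁴₀. The identity x - y
-- = (-y) - (-x) then trades a pair of classes (i, j) for (j + 2, i + 2), which rewrites every
-- difference from S₃ to S₂ as one from D⁴₀ ∪ D⁴₂ to D⁴₁ ∪ D⁴₃. The ℤ₂ label inside S₂ shares the
-- four class counts in T between the two directions, and changing s only swaps the shares.
--
-- The single cyclotomic numbers of order 4 depend on how q is written as a sum of two squares. T
-- runs over a whole orbit of them under multiplication by `α`, so averaging over F* takes the place
-- of evaluating them.
--
-- There is no slack: 2k(8k + 4) = 8k(2k + 1), so each (s, t) with t ≠ 0 occurs exactly 2k + 1
-- times, while (1, 0) never occurs.

private
  variable
    c ℓ p : Level
    A B C : Set c
    n : ℕ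

-- Sums over lists

∑ : (A → ℕ) → List A → ℕ
∑ f xs = sum (map f xs)

∑-cong : {f g : A → ℕ} → (∀ x → f x ≡ g x) → ∀ xs → ∑ f xs ≡ ∑ g xs
∑-cong f≗g xs = cong sum (map-cong f≗g xs)

∑-mono : {f g : A → ℕ} → (∀ x → f x ≤ g x) → ∀ xs → ∑ f xs ≤ ∑ g xs
∑-mono f≤g List.[]       = z≤n
∑-mono f≤g (x List.∷ xs) = +-mono-≤ (f≤g x) (∑-mono f≤g xs)

∑-++ : ∀ (f : A → ℕ) xs ys → ∑ f (xs ++ ys) ≡ ∑ f xs + ∑ f ys
∑-++ f xs ys = trans (cong sum (map-++ f xs ys)) (sum-++ (map f xs) (map f ys))

∑-map : ∀ (f : B → ℕ) (h : A → B) xs → ∑ f (map h xs) ≡ ∑ (f ∘ h) xs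
∑-map f h xs = cong sum (sym (map-∘ xs))

∑-cartesianProductWith : ∀ (f : C → ℕ) (h : A → B → C) xs ys →
  ∑ f (cartesianProductWith h xs ys) ≡ ∑ (λ x → ∑ (λ y → f (h x y)) ys) xs
∑-cartesianProductWith f h List.[]       ys = refl
∑-cartesianProductWith f h (x List.∷ xs) ys = trans
  (∑-++ f (map (h x) ys) (cartesianProductWith h xs ys))
  (cong₂ _+_ (∑-map f (h x) ys) (∑-cartesianProductWith f h xs ys))

∑-const : ∀ m (xs : List A) → ∑ (λ _ → m) xs ≡ length xs * m
∑-const m List.[]       = refl
∑-const m (x List.∷ xs) = cong (m +_) (∑-const m xs)

∑-* : ∀ m (f : A → ℕ) xs → ∑ (λ x → m * f x) xs ≡ m * ∑ f xs
∑-* m f List.[]       = sym (*-zeroʳ m)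
∑-* m f (x List.∷ xs) = trans (cong (m * f x +_) (∑-* m f xs)) (sym (*-distribˡ-+ m (f x) (∑ f xs)))

∑-+ : ∀ (f g : A → ℕ) xs → ∑ (λ x → f x + g x) xs ≡ ∑ f xs + ∑ g xs
∑-+ f g List.[]       = refl
∑-+ f g (x List.∷ xs) = trans (cong (f x + g x +_) (∑-+ f g xs))
  (solve 4 (λ a b c d → a :+ b :+ (c :+ d) := a :+ c :+ (b :+ d)) refl (f x) (g x) (∑ f xs) (∑ g xs))
  where open +-*-Solver

∑-swap : ∀ (h : A → B → ℕ) xs ys →
  ∑ (λ x → ∑ (h x) ys) xs ≡ ∑ (λ y → ∑ (λ x → h x y) xs) ys
∑-swap h List.[]       ys = sym (trans (∑-const 0 ys) (*-zeroʳ (length ys)))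
∑-swap h (x List.∷ xs) ys = trans (cong (∑ (h x) ys +_) (∑-swap h xs ys))
  (sym (∑-+ (h x) (λ y → ∑ (λ x → h x y) xs) ys))

∑-⊠ : ∀ (f : A → ℕ) m xs → ∑ f (m ⊠ xs) ≡ m * ∑ f xs
∑-⊠ f m List.[]       = sym (*-zeroʳ m)
∑-⊠ f m (x List.∷ xs) = begin
  ∑ f (replicate m x ++ m ⊠ xs)          ≡⟨ ∑-++ f (replicate m x) (m ⊠ xs) ⟩
  ∑ f (replicate m x) + ∑ f (m ⊠ xs)     ≡⟨ cong₂ _+_ (∑-replicate m) (∑-⊠ f m xs) ⟩
  m * f x + m * ∑ f xs                   ≡⟨ *-distribˡ-+ m (f x) (∑ f xs) ⟨
  m * (f x + ∑ f xs)                     ∎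
  where
  open ≡-Reasoning
  ∑-replicate : ∀ m → ∑ f (replicate m x) ≡ m * f x
  ∑-replicate zero    = refl
  ∑-replicate (suc m) = cong (f x +_) (∑-replicate m)

∑≡0 : ∀ {f : A → ℕ} {xs} → All (λ x → f x ≡ 0) xs → ∑ f xs ≡ 0
∑≡0 All.[]       = refl
∑≡0 (p All.∷ ps) = cong₂ _+_ p (∑≡0 ps)

length≡∑ : (xs : List A) → length xs ≡ ∑ (λ _ → 1) xs
length≡∑ xs = sym (trans (∑-const 1 xs) (ℕ.*-identityʳ (length xs)))

length-⊠ : ∀ m (xs : List A) → length (m ⊠ xs) ≡ m * length xs
length-⊠ m xs = begin
  length (m ⊠ xs)         ≡⟨ length≡∑ (m ⊠ xs) ⟩
  ∑ (λ _ → 1) (m ⊠ xs)    ≡⟨ ∑-⊠ (λ _ → 1) m xs ⟩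
  m * ∑ (λ _ → 1) xs      ≡⟨ cong (m *_) (length≡∑ xs) ⟨
  m * length xs           ∎
  where open ≡-Reasoning

-- Multiplicities are turned into sums of indicators, so that double counts can be exchanged and
-- factored by the rules for `∑`.
⟦_⟧ : {P : Set p} → Dec P → ℕ
⟦ P? ⟧ = if does P? then 1 else 0

⟦⟧-cong : {P : Set p} {Q : Set ℓ} {P? : Dec P} {Q? : Dec Q} → (P → Q) → (Q → P) → ⟦ P? ⟧ ≡ ⟦ Q? ⟧
⟦⟧-cong {P? = yes p} {yes q} f g = refl
⟦⟧-cong {P? = yes p} {no ¬q} f g = contradiction (f p) ¬q
⟦⟧-cong {P? = no ¬p} {yes q} f g = contradiction (g q) ¬p
⟦⟧-cong {P? = no ¬p} {no ¬q} f g = refl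

⟦⟧-no : {P : Set p} {P? : Dec P} → ¬ P → ⟦ P? ⟧ ≡ 0
⟦⟧-no {P? = yes p} ¬p = contradiction p ¬p
⟦⟧-no {P? = no  _} _  = refl

-- Serves to split an equation in ℤ₂ × F into its coordinates: a count there becomes a parity
-- indicator times a count in F.
⟦⟧-× : {P : Set p} {Q : Set ℓ} {R : Set c} {P? : Dec P} {Q? : Dec Q} {R? : Dec R} →
  (P → Q × R) → (Q → R → P) → ⟦ P? ⟧ ≡ ⟦ Q? ⟧ * ⟦ R? ⟧
⟦⟧-× {P? = P?} {yes q} {yes r} f g = ⟦⟧-cong {P? = P?} {Q? = yes r} (proj₂ ∘ f) (g q)
⟦⟧-× {P? = P?} {yes q} {no ¬r} f g = ⟦⟧-no {P? = P?} (¬r ∘ proj₂ ∘ f)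
⟦⟧-× {P? = P?} {no ¬q} {R?}    f g = ⟦⟧-no {P? = P?} (¬q ∘ proj₁ ∘ f)

length-filter : {P : A → Set p} (P? : Unary.Decidable P) →
  ∀ xs → length (filter P? xs) ≡ ∑ (λ x → ⟦ P? x ⟧) xs
length-filter P? List.[]       = refl
length-filter P? (x List.∷ xs) with P? x
... | yes _ = cong suc (length-filter P? xs)
... | no  _ = length-filter P? xs

-- Multiplicities in a finite abelian group

module _ (G : AbelianGroup c ℓ) (order : HasOrder (AbelianGroup.setoid G) n) where
  open AbelianGroup G using (Carrier; _≈_; ε; setoid) renaming (sym to ≈-sym; trans to ≈-trans)
  open Inverse order using (from; strictlyInverseʳ)
  open FiniteGroup G order
  open Uniqueness setoid using (Unique)
  open Membership setoid using (_∈_)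

  multiplicity≡∑ : ∀ x xs → multiplicity x xs ≡ ∑ (λ y → ⟦ x ≟ y ⟧) xs
  multiplicity≡∑ x = length-filter (x ≟_)

  -- The list that `G∖0` filters, so membership and length of `G∖0` are read off from it.
  elements : List Carrier
  elements = map from (allFin n)

  ∈-elements : ∀ x → x ∈ elements
  ∈-elements x = Anyₚ.map⁺ (Any.map
    (λ {i} eq → ≈-trans (≈-sym (strictlyInverseʳ x)) (AbelianGroup.reflexive G (cong from eq)))
    (∈-allFin (Inverse.to order x)))

  elements-unique : Unique elements
  elements-unique = Uniquenessₚ.map⁺ (≡.setoid (Fin n)) setoid
    (Injection.injective (Inverse⇒Injection (inverse-sym order)))
    (Uniquenessₚ.tabulate⁺ (≡.setoid (Fin n)) id)

  ∑-indicator≤1 : ∀ {xs} → Unique xs → ∀ x → ∑ (λ y → ⟦ y ≟ x ⟧) xs ≤ 1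
  ∑-indicator≤1 AllPairs.[]                           x = z≤n
  ∑-indicator≤1 {y List.∷ ys} (y∉ys AllPairs.∷ ys!) x = bound (y ≟ x)
    where
    bound : (y≟x : Dec (y ≈ x)) → ⟦ y≟x ⟧ + ∑ (λ y → ⟦ y ≟ x ⟧) ys ≤ 1
    bound (no _)    = ∑-indicator≤1 ys! x
    bound (yes y≈x) = ≤-reflexive (cong suc (∑≡0
      (All.map (λ {z} y≉z → ⟦⟧-no {P? = z ≟ x} (λ z≈x → y≉z (≈-trans y≈x (≈-sym z≈x)))) y∉ys)))

  multiplicity-∈ : ∀ {x xs} → x ∈ xs → 1 ≤ multiplicity x xs
  multiplicity-∈ {x} x∈xs = filter-some (x ≟_) x∈xs

  -- Double counting: each entry of `xs` is matched by exactly one member of the enumeration.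
  ∑-multiplicity : ∀ xs → ∑ (λ x → multiplicity x xs) elements ≡ length xs
  ∑-multiplicity xs = begin
    ∑ (λ x → multiplicity x xs) elements              ≡⟨ ∑-cong (λ x → multiplicity≡∑ x xs) elements ⟩
    ∑ (λ x → ∑ (λ y → ⟦ x ≟ y ⟧) xs) elements         ≡⟨ ∑-swap (λ x y → ⟦ x ≟ y ⟧) elements xs ⟩
    ∑ (λ y → ∑ (λ x → ⟦ x ≟ y ⟧) elements) xs         ≡⟨ ∑-cong one xs ⟩
    ∑ (λ _ → 1) xs                                    ≡⟨ length≡∑ xs ⟨
    length xs                                         ∎
    where
    open ≡-Reasoning
    one : ∀ y → ∑ (λ x → ⟦ x ≟ y ⟧) elements ≡ 1
    one y = ≤-antisym (∑-indicator≤1 elements-unique y) (≤-trans (multiplicity-∈ (∈-elements y))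
      (≤-reflexive (trans (multiplicity≡∑ y elements)
        (∑-cong (λ x → ⟦⟧-cong {P? = y ≟ x} {x ≟ y} ≈-sym ≈-sym) elements))))

  -- Summing the pointwise inequality over the group leaves only cardinalities, which is all that
  -- the lower bound on λ looks at.
  ⊆ᵐ⇒length≤ : ∀ xs ys → xs ⊆ᵐ ys → length xs ≤ length ys
  ⊆ᵐ⇒length≤ xs ys xs⊆ys = begin
    length xs                              ≡⟨ ∑-multiplicity xs ⟨
    ∑ (λ x → multiplicity x xs) elements   ≤⟨ ∑-mono xs⊆ys elements ⟩
    ∑ (λ x → multiplicity x ys) elements   ≡⟨ ∑-multiplicity ys ⟩
    length ys                              ∎
    where open ≤-Reasoning

  -- The filter rejects at least one entry, the one equal to `ε`.
  length-G∖0 : length G∖0 < n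
  length-G∖0 = subst (length G∖0 <_) (trans (length-map from (allFin n)) (length-tabulate {n = n} id))
    (filter-notAll (λ x → ¬? (x ≟ ε)) elements
      (Any.map (λ ε≈x x≉ε → x≉ε (≈-sym ε≈x)) (∈-elements ε)))

  ∈-G∖0 : ∀ {x} → ¬ (x ≈ ε) → x ∈ G∖0
  ∈-G∖0 x≉ε = Membershipₚ.∈-filter⁺ setoid (λ x → ¬? (x ≟ ε))
    (λ x≈y x≉ε y≈ε → x≉ε (≈-trans x≈y y≈ε)) (∈-elements _) x≉ε

  multiplicity-⊠-G∖0 : ∀ {x} μ → ¬ (x ≈ ε) → μ ≤ multiplicity x (μ ⊠ G∖0)
  multiplicity-⊠-G∖0 {x} μ x≉ε = begin
    μ                                   ≡⟨ ℕ.*-identityʳ μ ⟨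
    μ * 1                               ≤⟨ *-monoʳ-≤ μ (multiplicity-∈ (∈-G∖0 x≉ε)) ⟩
    μ * multiplicity x G∖0              ≡⟨ cong (μ *_) (multiplicity≡∑ x G∖0) ⟩
    μ * ∑ (λ y → ⟦ x ≟ y ⟧) G∖0         ≡⟨ ∑-⊠ (λ y → ⟦ x ≟ y ⟧) μ G∖0 ⟨
    ∑ (λ y → ⟦ x ≟ y ⟧) (μ ⊠ G∖0)       ≡⟨ multiplicity≡∑ x (μ ⊠ G∖0) ⟨
    multiplicity x (μ ⊠ G∖0)            ∎
    where open ≤-Reasoning

-- Weights and the lower bound for block sizes 2, 2k, 2k

lcm[2,2k,2k] : ∀ k → lcm 2 (lcm (2 * k) (lcm (2 * k) 1)) ≡ 2 * k
lcm[2,2k,2k] k = ∣-antisym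
  (lcm-least (m∣m*n k) (lcm-least ∣-refl (lcm-least ∣-refl (1∣ (2 * k)))))
  (∣-trans (m∣lcm[m,n] (2 * k) _) (n∣lcm[m,n] 2 _))

/-exact : ∀ {m n} w → .{{_ : NonZero n}} → m ≡ w * n → m / n ≡ w
/-exact {n = n} w refl = m*n/n≡m w n

module _ (G : AbelianGroup c ℓ) where
  open AbelianGroup G using (Carrier)
  open Differences G

  module _ (k : ℕ) (B : Vector (List Carrier) 3) .(ne : ∀ i → NonZero (sizes B i))
           (size : ∀ i → sizes B i ≡ (2 ∷ 2 * k ∷ 2 * k ∷ []) i) where

    private
      B₀ = B 0F
      B₁ = B 1F
      B₂ = B 2F

    lcm-sizes : Vector.foldr lcm 1 (sizes B) ≡ 2 * k
    lcm-sizes = trans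
      (cong₂ lcm (size 0F) (cong₂ lcm (size 1F) (cong (λ m → lcm m 1) (size 2F))))
      (lcm[2,2k,2k] k)

    -- Describing the weight `w` by a product removes the truncated division from everything that
    -- follows.
    weighted-by : ∀ i w → 2 * k ≡ w * (2 ∷ 2 * k ∷ 2 * k ∷ []) i → weighted B ne i ≡ w ⊠ B i
    weighted-by i w eq = cong (_⊠ B i)
      (/-exact w {{ne i}} (trans lcm-sizes (trans eq (cong (w *_) (sym (size i))))))

    length-weighted : ∀ i w → 2 * k ≡ w * (2 ∷ 2 * k ∷ 2 * k ∷ []) i → length (weighted B ne i) ≡ 2 * k
    length-weighted i w eq = trans (cong length (weighted-by i w eq))
      (trans (length-⊠ w (B i)) (trans (cong (w *_) (size i)) (sym eq)))

    weights : ∀ i → ∃ λ w → 2 * k ≡ w * (2 ∷ 2 * k ∷ 2 * k ∷ []) i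
    weights 0F = k , ℕ.*-comm 2 k
    weights 1F = 1 , sym (ℕ.*-identityˡ (2 * k))
    weights 2F = 1 , sym (ℕ.*-identityˡ (2 * k))

    -- The filter on pairs from `Fin 3` evaluates, leaving the six ordered pairs in lexicographic
    -- order followed by the empty list.
    ∑-externalDifferences : ∀ (f : Carrier → ℕ) →
      let W = weighted B ne in
      ∑ f (externalDifferences B ne) ≡
        ∑ f (D B₀ (W 1F)) + (∑ f (D B₀ (W 2F)) + (∑ f (D B₁ (W 0F)) +
        (∑ f (D B₁ (W 2F)) + (∑ f (D B₂ (W 0F)) + (∑ f (D B₂ (W 1F)) + 0)))))
    ∑-externalDifferences f =
      step (D B₀ _) (step (D B₀ _) (step (D B₁ _) (step (D B₁ _) (step (D B₂ _) (step {List.[]} (D B₂ _) refl)))))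
      where
      step : ∀ {ys m} xs → ∑ f ys ≡ m → ∑ f (xs ++ ys) ≡ ∑ f xs + m
      step {ys} xs eq = trans (∑-++ f xs ys) (cong (∑ f xs +_) eq)

    -- Every weighted block has 2k entries, and each index comes first in two of the six pairs. The
    -- total is therefore 2k times twice the sum 4k + 2 of the sizes.
    length-externalDifferences : length (externalDifferences B ne) ≡ (2 * k) * (8 * k + 4)
    length-externalDifferences = begin
      length (externalDifferences B ne)
        ≡⟨ length≡∑ (externalDifferences B ne) ⟩
      ∑ (λ _ → 1) (externalDifferences B ne)
        ≡⟨ ∑-externalDifferences (λ _ → 1) ⟩
      _
        ≡⟨ cong₂ _+_ (count 0F 1F) (cong₂ _+_ (count 0F 2F) (cong₂ _+_ (count 1F 0F)
          (cong₂ _+_ (count 1F 2F) (cong₂ _+_ (count 2F 0F) (cong (_+ 0) (count 2F 1F)))))) ⟩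
      _
        ≡⟨ solve 1 (λ k → let m = con 2 :* k in
             con 2 :* m :+ (con 2 :* m :+ (m :* m :+ (m :* m :+ (m :* m :+ (m :* m :+ con 0)))))
             := m :* (con 8 :* k :+ con 4)) refl k ⟩
      (2 * k) * (8 * k + 4)
        ∎
      where
      open ≡-Reasoning
      open +-*-Solver
      count : ∀ i j → ∑ (λ _ → 1) (D (B i) (weighted B ne j)) ≡ (2 ∷ 2 * k ∷ 2 * k ∷ []) i * (2 * k)
      count i j = begin
        ∑ (λ _ → 1) (D (B i) (weighted B ne j))          ≡⟨ ∑-cartesianProductWith (λ _ → 1) _ (B i) (weighted B ne j) ⟩
        ∑ (λ _ → ∑ (λ _ → 1) (weighted B ne j)) (B i)    ≡⟨ ∑-const _ (B i) ⟩
        length (B i) * ∑ (λ _ → 1) (weighted B ne j)     ≡⟨ cong₂ _*_ (size i) (trans (sym (length≡∑ (weighted B ne j)))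
                                                             (length-weighted j (proj₁ (weights j)) (proj₂ (weights j)))) ⟩
        (2 ∷ 2 * k ∷ 2 * k ∷ []) i * (2 * k)             ∎

    -- Only the sizes of the blocks enter the count, so the bound reaches every competitor in every
    -- group of order 2q.
    counting-bound : 1 ≤ k → ∀ {q} → q ≡ 4 * k + 1 → (order : HasOrder (AbelianGroup.setoid G) (2 * q)) →
      let open FiniteGroup G order in ∀ μ → externalDifferences B ne ⊆ᵐ μ ⊠ G∖0 → 2 * k + 1 ≤ μ
    counting-bound 1≤k refl order μ ext⊆ = ≮⇒≥ λ μ<2k+1 → <⇒≱ six-more (too-many μ<2k+1)
      where
      open FiniteGroup G order
      open ≤-Reasoning
      open +-*-Solver
      too-many : μ < 2 * k + 1 → (2 * k) * (8 * k + 4) ≤ (2 * k) * (8 * k + 1)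
      too-many μ<2k+1 = begin
        (2 * k) * (8 * k + 4)               ≡⟨ length-externalDifferences ⟨
        length (externalDifferences B ne)   ≤⟨ ⊆ᵐ⇒length≤ G order (externalDifferences B ne) (μ ⊠ G∖0) ext⊆ ⟩
        length (μ ⊠ G∖0)                    ≡⟨ length-⊠ μ G∖0 ⟩
        μ * length G∖0                      ≤⟨ *-mono-≤ {μ} {2 * k} {length G∖0} {8 * k + 1}
                                                 (m<1+n⇒m≤n (subst (μ <_) (ℕ.+-comm (2 * k) 1) μ<2k+1))
                                                 (m<1+n⇒m≤n (subst (length G∖0 <_)
                                                   (solve 1 (λ k → con 2 :* (con 4 :* k :+ con 1)
                                                     := con 1 :+ (con 8 :* k :+ con 1)) refl k)
                                                   (length-G∖0 G order))) ⟩
        (2 * k) * (8 * k + 1)               ∎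
      six-more : (2 * k) * (8 * k + 1) < (2 * k) * (8 * k + 4)
      six-more = begin-strict
        -- The gap is 2k · 3 = 6k; it unfolds to `k + 5 * k`, hence is positive.
        (2 * k) * (8 * k + 1)         <⟨ m<m+n _ (≤-trans 1≤k (m≤m+n k (5 * k))) ⟩
        (2 * k) * (8 * k + 1) + 6 * k ≡⟨ solve 1 (λ k → con 2 :* k :* (con 8 :* k :+ con 1) :+ con 6 :* k
                                           := con 2 :* k :* (con 8 :* k :+ con 4)) refl k ⟩
        (2 * k) * (8 * k + 4)         ∎

-- Powers of the primitive element and its order

module Cyclotomy (F : CommutativeRing c ℓ) {q : ℕ} (isField : IsFieldOfOrder F q)
                 (α : CommutativeRing.Carrier F) (α-primitive : Construction.IsPrimitive F α)
                 (k h : ℕ) (k≡2h+1 : k ≡ 1 + 2 * h) (q≡4k+1 : q ≡ 4 * k + 1) where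

  open CommutativeRing F
    using (Carrier; _≈_; 0#; 1#; -_; _-_; setoid; *-congˡ; *-congʳ; *-identityˡ; *-identityʳ;
           *-assoc; *-comm; zeroʳ; +-cong; +-congˡ; +-congʳ; -‿cong; -‿inverseʳ; +-identityʳ;
           +-comm; distribˡ; +-abelianGroup; ring; semiring)
    renaming (_*_ to _·_; _+_ to _⊕_; refl to ≈-refl; sym to ≈-sym; trans to ≈-trans)
  open IsFieldOfOrder isField
  open Exp semiring using (_^_; ^-homo-*; ^-assocʳ; ^-congˡ)
  open Ringₚ ring using (x[y-z]≈xy-xz; -1*x≈-x; -‿involutive)
  open AbelianGroupₚ +-abelianGroup using (x∙y⁻¹≈ε⇒x≈y; ⁻¹-anti-homo‿-; inverseˡ-unique; ε⁻¹≈ε)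
  open Construction F using (D⁴)
  open FiniteGroup +-abelianGroup order using (_≟_) public
  open Uniqueness setoid using (Unique)
  open Disjointness setoid using (Disjoint)
  open Membership setoid using (_∈_)
  module ≈-Reasoning = SetoidReasoning setoid

  instance
    k≢0 : NonZero k
    k≢0 = subst NonZero (sym k≡2h+1) _

    4k≢0 : NonZero (4 * k)
    4k≢0 = ℕ.m*n≢0 4 k

  α≉0 : ¬ (α ≈ 0#)
  α≉0 = proj₁ α-primitive

  log : ∀ x → ¬ (x ≈ 0#) → ∃ λ i → x ≈ α ^ i
  log = proj₂ α-primitive

  ·-cancelˡ : ∀ x {y z} → ¬ (x ≈ 0#) → x · y ≈ x · z → y ≈ z
  ·-cancelˡ x {y} {z} x≉0 xy≈xz = begin
    y             ≈⟨ left-inverse y ⟨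
    x⁻¹ · (x · y) ≈⟨ *-congˡ xy≈xz ⟩
    x⁻¹ · (x · z) ≈⟨ left-inverse z ⟩
    z             ∎
    where
    open ≈-Reasoning
    x⁻¹ = proj₁ (inv x x≉0)
    left-inverse : ∀ w → x⁻¹ · (x · w) ≈ w
    left-inverse w = begin
      x⁻¹ · (x · w)  ≈⟨ *-assoc x⁻¹ x w ⟨
      (x⁻¹ · x) · w  ≈⟨ *-congʳ (≈-trans (*-comm x⁻¹ x) (proj₂ (inv x x≉0))) ⟩
      1# · w         ≈⟨ *-identityˡ w ⟩
      w              ∎

  ·-nonzero : ∀ {x y} → ¬ (x ≈ 0#) → ¬ (y ≈ 0#) → ¬ (x · y ≈ 0#)
  ·-nonzero {x} x≉0 y≉0 xy≈0 = y≉0 (·-cancelˡ x x≉0 (≈-trans xy≈0 (≈-sym (zeroʳ x))))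

  ^-nonzero : ∀ n → ¬ (α ^ n ≈ 0#)
  ^-nonzero zero    = 1≉0
  ^-nonzero (suc n) = ·-nonzero α≉0 (^-nonzero n)

  ^-quotient : ∀ {m n} → m ≤ n → α ^ m ≈ α ^ n → α ^ (n ∸ m) ≈ 1#
  ^-quotient {m} {n} m≤n eq = ·-cancelˡ (α ^ m) (^-nonzero m) (begin
    α ^ m · α ^ (n ∸ m) ≈⟨ ^-homo-* α m (n ∸ m) ⟨
    α ^ (m + (n ∸ m))   ≡⟨ cong (α ^_) (m+[n∸m]≡n m≤n) ⟩
    α ^ n               ≈⟨ eq ⟨
    α ^ m               ≈⟨ *-identityʳ (α ^ m) ⟨
    α ^ m · 1#          ∎)
    where open ≈-Reasoning

  1^n≈1 : ∀ n → 1# ^ n ≈ 1#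
  1^n≈1 zero    = ≈-refl
  1^n≈1 (suc n) = ≈-trans (*-identityˡ (1# ^ n)) (1^n≈1 n)

  ^-reduce : ∀ d .{{_ : NonZero d}} → α ^ d ≈ 1# → ∀ n → α ^ n ≈ α ^ (n % d)
  ^-reduce d α^d≈1 n = begin
    α ^ n                           ≡⟨ cong (α ^_) (m≡m%n+[m/n]*n n d) ⟩
    α ^ (n % d + n / d * d)         ≈⟨ ^-homo-* α (n % d) (n / d * d) ⟩
    α ^ (n % d) · α ^ (n / d * d)   ≡⟨ cong (λ m → α ^ (n % d) · α ^ m) (ℕ.*-comm (n / d) d) ⟩
    α ^ (n % d) · α ^ (d * (n / d)) ≈⟨ *-congˡ (^-assocʳ α d (n / d)) ⟨
    α ^ (n % d) · (α ^ d) ^ (n / d) ≈⟨ *-congˡ (≈-trans (^-congˡ (n / d) α^d≈1) (1^n≈1 (n / d))) ⟩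
    α ^ (n % d) · 1#                ≈⟨ *-identityʳ (α ^ (n % d)) ⟩
    α ^ (n % d)                     ∎
    where open ≈-Reasoning

  from-injective : ∀ {i j} → Inverse.from order i ≈ Inverse.from order j → i ≡ j
  from-injective = Injection.injective (Inverse⇒Injection (inverse-sym order))

  to-injective : ∀ {x y} → Inverse.to order x ≡ Inverse.to order y → x ≈ y
  to-injective = Injection.injective (Inverse⇒Injection order)

  -- If αᵈ = 1, the elements of F are labelled injectively by 0 and the exponents mod d.
  period≥4k : ∀ d → 0 < d → α ^ d ≈ 1# → 4 * k ≤ d
  period≥4k d 0<d α^d≈1 = +-cancelʳ-≤ 1 (4 * k) d
    (subst₂ _≤_ q≡4k+1 (sym (ℕ.+-comm d 1))
      (injective⇒≤ {f = label ∘ Inverse.from order} (from-injective ∘ label-injective)))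
    where
    open ≈-Reasoning
    instance
      d≢0 : NonZero d
      d≢0 = >-nonZero 0<d

    label : Carrier → Fin (suc d)
    label x with x ≟ 0#
    ... | yes _   = zero
    ... | no  x≉0 = suc (fromℕ< (m%n<n (proj₁ (log x x≉0)) d))

    label-injective : ∀ {x y} → label x ≡ label y → x ≈ y
    label-injective {x} {y} eq with x ≟ 0# | y ≟ 0#
    ... | yes x≈0 | yes y≈0 = ≈-trans x≈0 (≈-sym y≈0)
    ... | no  x≉0 | no  y≉0 with log x x≉0 | log y y≉0
    ...   | m , x≈α^m | n , y≈α^n = begin
      x            ≈⟨ x≈α^m ⟩
      α ^ m        ≈⟨ ^-reduce d α^d≈1 m ⟩
      α ^ (m % d)  ≡⟨ cong (α ^_) (Fin.fromℕ<-injective (m % d) (n % d) (m%n<n m d) (m%n<n n d) (Fin.suc-injective eq)) ⟩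
      α ^ (n % d)  ≈⟨ ^-reduce d α^d≈1 n ⟨
      α ^ n        ≈⟨ y≈α^n ⟨
      y            ∎

  -- Pigeonhole on the q + 1 entries 0, α⁰, ..., α^(q-1). No power is 0, so two powers collide.
  -- Including 0 among the entries keeps the exponents below q, whence d is at most q - 1 = 4k and
  -- not merely q.
  some-period : ∃ λ d → 0 < d × d ≤ 4 * k × α ^ d ≈ 1#
  some-period with pigeonhole (n<1+n q) entry
    where
    entry : Fin (suc q) → Fin q
    entry zero    = Inverse.to order 0#
    entry (suc i) = Inverse.to order (α ^ toℕ i)
  ... | zero  , suc j , _         , eq = contradiction (≈-sym (to-injective eq)) (^-nonzero (toℕ j))
  ... | suc i , suc j , s≤s i<j , eq =
    toℕ j ∸ toℕ i , m<n⇒0<n∸m i<j ,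
    ≤-trans (m∸n≤m (toℕ j) (toℕ i)) (m<1+n⇒m≤n (subst (toℕ j <_) q≡1+4k (toℕ<n j))) ,
    ^-quotient (<⇒≤ i<j) (to-injective eq)
    where
    q≡1+4k : q ≡ 1 + 4 * k
    q≡1+4k = trans q≡4k+1 (ℕ.+-comm (4 * k) 1)

  -- The period found by pigeonhole is at most 4k, and every positive period is at least 4k.
  α^4k≈1 : α ^ (4 * k) ≈ 1#
  α^4k≈1 = let d , 0<d , d≤4k , α^d≈1 = some-period in
    subst (λ n → α ^ n ≈ 1#) (≤-antisym d≤4k (period≥4k d 0<d α^d≈1)) α^d≈1

  ^-distinct : ∀ {m n} → m < n → n < 4 * k → ¬ (α ^ m ≈ α ^ n)
  ^-distinct {m} {n} m<n n<4k eq = <⇒≱ n<4k (≤-trans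
    (period≥4k (n ∸ m) (m<n⇒0<n∸m m<n) (^-quotient (<⇒≤ m<n) eq)) (m∸n≤m n m))

  ^-injective : ∀ {m n} → m < 4 * k → n < 4 * k → α ^ m ≈ α ^ n → m ≡ n
  ^-injective {m} {n} m<4k n<4k eq with <-cmp m n
  ... | tri< m<n _ _ = contradiction eq (^-distinct m<n n<4k)
  ... | tri≈ _ m≡n _ = m≡n
  ... | tri> _ _ n<m = contradiction (≈-sym eq) (^-distinct n<m m<4k)

  -- α²ᵏ is a root of x² = 1 other than 1.
  α^2k≈-1 : α ^ (2 * k) ≈ - 1#
  α^2k≈-1 = inverseˡ-unique u 1# (·-cancelˡ (u - 1#) u-1≉0 (begin
    (u - 1#) · (u ⊕ 1#)              ≈⟨ distribˡ (u - 1#) u 1# ⟩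
    (u - 1#) · u ⊕ (u - 1#) · 1#     ≈⟨ +-cong (*-comm (u - 1#) u) (*-identityʳ (u - 1#)) ⟩
    u · (u - 1#) ⊕ (u - 1#)          ≈⟨ +-congʳ (x[y-z]≈xy-xz u u 1#) ⟩
    (u · u - u · 1#) ⊕ (u - 1#)      ≈⟨ +-congʳ (+-cong u·u≈1 (-‿cong (*-identityʳ u))) ⟩
    (1# - u) ⊕ (u - 1#)              ≈⟨ +-congˡ (⁻¹-anti-homo‿- 1# u) ⟨
    (1# - u) ⊕ (- (1# - u))          ≈⟨ -‿inverseʳ (1# - u) ⟩
    0#                               ≈⟨ zeroʳ (u - 1#) ⟨
    (u - 1#) · 0#                    ∎))
    where
    open ≈-Reasoning
    u = α ^ (2 * k)
    u·u≈1 : u · u ≈ 1#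
    u·u≈1 = begin
      u · u               ≈⟨ ^-homo-* α (2 * k) (2 * k) ⟨
      α ^ (2 * k + 2 * k) ≡⟨ cong (α ^_) (*-distribʳ-+ k 2 2) ⟨
      α ^ (4 * k)         ≈⟨ α^4k≈1 ⟩
      1#                  ∎
    u-1≉0 : ¬ (u - 1# ≈ 0#)
    u-1≉0 eq = ^-distinct {0} {2 * k} (>-nonZero⁻¹ (2 * k) {{ℕ.m*n≢0 2 k}})
      (*-monoˡ-< k {2} {4} (s≤s (s≤s (s≤s z≤n)))) (≈-sym (x∙y⁻¹≈ε⇒x≈y u 1# eq))

  -- The cyclotomic classes of order 4

  private
    D₄ : ℕ → List Carrier
    D₄ = D⁴ α k

  length-D⁴ : ∀ i → length (D₄ i) ≡ k
  length-D⁴ i = trans (length-map _ (upTo k)) (length-upTo k)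

  ∈-D⁴⁻ : ∀ {x} i → x ∈ D₄ i → ∃ λ j → j < k × x ≈ α ^ (i + 4 * j)
  ∈-D⁴⁻ {x} i x∈D = Anyₚ.applyUpTo⁻ (λ j → α ^ (i + 4 * j))
    (subst (x ∈_) (map-upTo (λ j → α ^ (i + 4 * j)) k) x∈D)

  ∈-D⁴⇒≉0 : ∀ {x} i → x ∈ D₄ i → ¬ (x ≈ 0#)
  ∈-D⁴⇒≉0 i x∈D x≈0 = let j , _ , x≈ = ∈-D⁴⁻ i x∈D in ^-nonzero (i + 4 * j) (≈-trans (≈-sym x≈) x≈0)

  exponent<4k : ∀ {i j} → i < 4 → j < k → i + 4 * j < 4 * k
  exponent<4k {i} {j} i<4 j<k = <-≤-trans (+-monoˡ-< (4 * j) i<4)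
    (≤-trans (≤-reflexive (sym (*-suc 4 j))) (*-monoʳ-≤ 4 j<k))

  D⁴-unique : ∀ i → i < 4 → Unique (D₄ i)
  D⁴-unique i i<4 = subst Unique (sym (map-upTo _ k))
    (Uniquenessₚ.applyUpTo⁺₁ setoid _ k λ j<j′ j′<k →
      ^-distinct (+-monoʳ-< i (*-monoʳ-< 4 j<j′)) (exponent<4k i<4 j′<k))

  -- A common element would be a power with two exponents below 4k. These coincide, and their
  -- residues modulo 4 are `i` and `j`.
  D⁴-disjoint : ∀ {i j} → i < 4 → j < 4 → i ≢ j → Disjoint (D₄ i) (D₄ j)
  D⁴-disjoint {i} {j} i<4 j<4 i≢j (x∈Dᵢ , x∈Dⱼ) =
    let m , m<k , x≈α^m = ∈-D⁴⁻ i x∈Dᵢ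
        n , n<k , x≈α^n = ∈-D⁴⁻ j x∈Dⱼ
        eq = ^-injective (exponent<4k i<4 m<k) (exponent<4k j<4 n<k) (≈-trans (≈-sym x≈α^m) x≈α^n)
    in i≢j (trans (sym (residue m i<4)) (trans (cong (_% 4) eq) (residue n j<4)))
    where
    residue : ∀ {i} m → i < 4 → (i + 4 * m) % 4 ≡ i
    residue {i} m i<4 = trans (cong (λ n → (i + n) % 4) (ℕ.*-comm 4 m))
      (trans ([m+kn]%n≡m%n i m 4) (m<n⇒m%n≡m i<4))

  -- The 4k nonzero elements, class by class. Absence of repetitions is what the later upper bounds
  -- on counts draw from this list.
  F* : List Carrier
  F* = D₄ 0 ++ D₄ 1 ++ D₄ 2 ++ D₄ 3

  0<4 = s≤s (z≤n {3})
  1<4 = s≤s (s≤s (z≤n {2}))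
  2<4 = s≤s (s≤s (s≤s (z≤n {1})))
  3<4 = s≤s (s≤s (s≤s (s≤s (z≤n {0}))))

  Disjoint-++ : ∀ {xs ys zs} → Disjoint xs ys → Disjoint xs zs → Disjoint xs (ys ++ zs)
  Disjoint-++ {ys = ys} d e (v∈xs , v∈yszs) with Membershipₚ.∈-++⁻ setoid ys v∈yszs
  ... | inj₁ v∈ys = d (v∈xs , v∈ys)
  ... | inj₂ v∈zs = e (v∈xs , v∈zs)

  F*-unique : Unique F*
  F*-unique = Uniquenessₚ.++⁺ setoid (D⁴-unique 0 0<4)
    (Uniquenessₚ.++⁺ setoid (D⁴-unique 1 1<4)
      (Uniquenessₚ.++⁺ setoid (D⁴-unique 2 2<4) (D⁴-unique 3 3<4) (D⁴-disjoint 2<4 3<4 λ ()))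
      (Disjoint-++ (D⁴-disjoint 1<4 2<4 λ ()) (D⁴-disjoint 1<4 3<4 λ ())))
    (Disjoint-++ (D⁴-disjoint 0<4 1<4 λ ()) (Disjoint-++ (D⁴-disjoint 0<4 2<4 λ ()) (D⁴-disjoint 0<4 3<4 λ ())))

  ∑-F* : ∀ f → ∑ f F* ≡ ∑ f (D₄ 0) + (∑ f (D₄ 1) + (∑ f (D₄ 2) + ∑ f (D₄ 3)))
  ∑-F* f = trans (∑-++ f (D₄ 0) _) (cong (∑ f (D₄ 0) +_)
    (trans (∑-++ f (D₄ 1) _) (cong (∑ f (D₄ 1) +_) (∑-++ f (D₄ 2) (D₄ 3)))))

  -- Equality in F is a setoid relation, so a summand must be compatible with it before equal powers
  -- of `α` may be interchanged.
  Respects : (Carrier → ℕ) → Set _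
  Respects f = ∀ {x y} → x ≈ y → f x ≡ f y

  D⁴-suc : ∀ i → D₄ (suc i) ≡ map (α ·_) (D₄ i)
  D⁴-suc i = map-∘ (upTo k)

  ^-cyclic : ∀ i → α ^ (i + 4 * k) ≈ α ^ (i + 0)
  ^-cyclic i = begin
    α ^ (i + 4 * k)       ≈⟨ ^-homo-* α i (4 * k) ⟩
    α ^ i · α ^ (4 * k)   ≈⟨ *-congˡ α^4k≈1 ⟩
    α ^ i · 1#            ≈⟨ *-identityʳ (α ^ i) ⟩
    α ^ i                 ≡⟨ cong (α ^_) (ℕ.+-identityʳ i) ⟨
    α ^ (i + 0)           ∎
    where open ≈-Reasoning

  -- Raising i by 4 shifts the exponents by one place, and α^(i+4k) = α^i closes the cycle.
  ∑-D⁴-period : ∀ {f} → Respects f → ∀ i → ∑ f (D₄ (4 + i)) ≡ ∑ f (D₄ i)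
  ∑-D⁴-period {f} resp i = +-cancelˡ-≡ (g 0) _ _ (begin
    g 0 + ∑ f (D₄ (4 + i))       ≡⟨ cong (g 0 +_) shifted ⟩
    ∑ g (upTo (suc k))           ≡⟨ cong (∑ g) (upTo-∷ʳ k) ⟨
    ∑ g (upTo k List.∷ʳ k)       ≡⟨ ∑-++ g (upTo k) List.[ k ] ⟩
    ∑ g (upTo k) + (g k + 0)     ≡⟨ cong₂ _+_ (sym (∑-map f _ (upTo k))) (ℕ.+-identityʳ (g k)) ⟩
    ∑ f (D₄ i) + g k             ≡⟨ ℕ.+-comm (∑ f (D₄ i)) (g k) ⟩
    g k + ∑ f (D₄ i)             ≡⟨ cong (_+ ∑ f (D₄ i)) (resp (^-cyclic i)) ⟩
    g 0 + ∑ f (D₄ i)             ∎)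
    where
    open ≡-Reasoning
    g : ℕ → ℕ
    g j = f (α ^ (i + 4 * j))
    index : ∀ j → 4 + i + 4 * j ≡ i + 4 * suc j
    index j = solve 2 (λ i j → con 4 :+ i :+ con 4 :* j := i :+ con 4 :* (con 1 :+ j)) refl i j
      where open +-*-Solver
    shifted : ∑ f (D₄ (4 + i)) ≡ ∑ g (applyUpTo suc k)
    shifted = begin
      ∑ f (D₄ (4 + i))                           ≡⟨ ∑-map f _ (upTo k) ⟩
      ∑ (λ j → f (α ^ (4 + i + 4 * j))) (upTo k) ≡⟨ ∑-cong (λ j → cong (λ m → f (α ^ m)) (index j)) (upTo k) ⟩
      ∑ (g ∘ suc) (upTo k)                       ≡⟨ ∑-map g suc (upTo k) ⟨
      ∑ g (map suc (upTo k))                     ≡⟨ cong (∑ g) (map-upTo suc k) ⟩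
      ∑ g (applyUpTo suc k)                      ∎

  -- Written with `m * 4` so that `suc m * 4 + i` unfolds to `4 + (m * 4 + i)` and the induction
  -- needs no rearrangement.
  ∑-D⁴-periods : ∀ {f} → Respects f → ∀ m i → ∑ f (D₄ (m * 4 + i)) ≡ ∑ f (D₄ i)
  ∑-D⁴-periods resp zero    i = refl
  ∑-D⁴-periods resp (suc m) i = trans (∑-D⁴-period resp (m * 4 + i)) (∑-D⁴-periods resp m i)

  -- Negation multiplies by α²ᵏ, and 2k = 4h + 2 because k is odd.
  -α^ : ∀ i j → - (α ^ (i + 4 * j)) ≈ α ^ (h * 4 + (2 + i) + 4 * j)
  -α^ i j = begin
    - (α ^ (i + 4 * j))              ≈⟨ -1*x≈-x (α ^ (i + 4 * j)) ⟨
    - 1# · α ^ (i + 4 * j)           ≈⟨ *-congʳ α^2k≈-1 ⟨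
    α ^ (2 * k) · α ^ (i + 4 * j)    ≈⟨ ^-homo-* α (2 * k) (i + 4 * j) ⟨
    α ^ (2 * k + (i + 4 * j))        ≡⟨ cong (α ^_) index ⟩
    α ^ (h * 4 + (2 + i) + 4 * j)    ∎
    where
    open ≈-Reasoning
    open +-*-Solver
    index : 2 * k + (i + 4 * j) ≡ h * 4 + (2 + i) + 4 * j
    index = trans (cong (λ m → 2 * m + (i + 4 * j)) k≡2h+1)
      (solve 3 (λ h i j → con 2 :* (con 1 :+ con 2 :* h) :+ (i :+ con 4 :* j) :=
        h :* con 4 :+ (con 2 :+ i) :+ con 4 :* j) refl h i j)

  -- Negation carries class i onto class i + 2, up to the order of the entries: the exponent moves
  -- by 4h + 2, and the h full periods drop out.
  ∑-D⁴-neg : ∀ {f} → Respects f → ∀ i → ∑ (f ∘ -_) (D₄ i) ≡ ∑ f (D₄ (2 + i))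
  ∑-D⁴-neg {f} resp i = begin
    ∑ (f ∘ -_) (D₄ i)                                    ≡⟨ ∑-map (f ∘ -_) _ (upTo k) ⟩
    ∑ (λ j → f (- (α ^ (i + 4 * j)))) (upTo k)           ≡⟨ ∑-cong (λ j → resp (-α^ i j)) (upTo k) ⟩
    ∑ (λ j → f (α ^ (h * 4 + (2 + i) + 4 * j))) (upTo k) ≡⟨ ∑-map f _ (upTo k) ⟨
    ∑ f (D₄ (h * 4 + (2 + i)))                           ≡⟨ ∑-D⁴-periods resp h (2 + i) ⟩
    ∑ f (D₄ (2 + i))                                     ∎
    where open ≡-Reasoning

  -- Counting representations as differences in F

  δ : Carrier → Carrier → ℕ
  δ t u = ⟦ t ≟ u ⟧

  δ-cong : ∀ {t t′ u u′} → (t ≈ u → t′ ≈ u′) → (t′ ≈ u′ → t ≈ u) → δ t u ≡ δ t′ u′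
  δ-cong {t} {t′} {u} {u′} = ⟦⟧-cong {P? = t ≟ u} {t′ ≟ u′}

  δ-respʳ : ∀ t → Respects (δ t)
  δ-respʳ t {x} {y} x≈y = δ-cong (λ t≈x → ≈-trans t≈x x≈y) (λ t≈y → ≈-trans t≈y (≈-sym x≈y))

  N : Carrier → List Carrier → List Carrier → ℕ
  N t xs ys = ∑ (λ x → ∑ (λ y → δ t (x - y)) ys) xs

  N-respects : ∀ xs ys → Respects (λ t → N t xs ys)
  N-respects xs ys {t} {u} t≈u = ∑-cong (λ x → ∑-cong (λ y →
    δ-cong (≈-trans (≈-sym t≈u)) (≈-trans t≈u)) ys) xs

  N-++ʳ : ∀ t xs ys zs → N t xs (ys ++ zs) ≡ N t xs ys + N t xs zs
  N-++ʳ t xs ys zs = trans (∑-cong (λ x → ∑-++ _ ys zs) xs) (∑-+ _ _ xs)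

  N-disjoint : ∀ {t xs ys} → t ≈ 0# → Disjoint xs ys → N t xs ys ≡ 0
  N-disjoint {t} {xs} {ys} t≈0 xs#ys = ∑≡0 (All.tabulateₛ setoid λ {x} x∈xs → ∑≡0 (All.tabulateₛ setoid λ {y} y∈ys →
    ⟦⟧-no {P? = t ≟ (x - y)} λ t≈x-y →
      xs#ys (x∈xs , Membershipₚ.∈-resp-≈ setoid
        (≈-sym (x∙y⁻¹≈ε⇒x≈y x y (≈-trans (≈-sym t≈x-y) t≈0))) y∈ys)))

  -- Each pair (x, y) is counted for at most one t, since x - y appears at most once in `F*`.
  ∑-N : ∀ xs ys → ∑ (λ t → N t xs ys) F* ≤ length xs * length ys
  ∑-N xs ys = begin
    ∑ (λ t → N t xs ys) F*                                ≡⟨ ∑-swap _ F* xs ⟩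
    ∑ (λ x → ∑ (λ t → ∑ (λ y → δ t (x - y)) ys) F*) xs    ≡⟨ ∑-cong (λ x → ∑-swap _ F* ys) xs ⟩
    ∑ (λ x → ∑ (λ y → ∑ (λ t → δ t (x - y)) F*) ys) xs    ≤⟨ ∑-mono (λ x → ∑-mono (λ y → ∑-indicator≤1 +-abelianGroup order F*-unique (x - y)) ys) xs ⟩
    ∑ (λ x → ∑ (λ y → 1) ys) xs                           ≡⟨ ∑-const _ xs ⟩
    length xs * ∑ (λ y → 1) ys                            ≡⟨ cong (length xs *_) (length≡∑ ys) ⟨
    length xs * length ys                                 ∎
    where open ≤-Reasoning

  -- At t = 1 this is the cyclotomic number (j, i) of order 4: the number of y in class j with y + 1
  -- in class i.
  n[_,_] : ℕ → ℕ → Carrier → ℕ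
  n[ i , j ] t = N t (D₄ i) (D₄ j)

  -- Class indices are plain natural numbers. This lemma and the next reduce those that scaling and
  -- flipping push to 4 or beyond.
  n-periodˡ : ∀ i j t → n[ 4 + i , j ] t ≡ n[ i , j ] t
  n-periodˡ i j t = ∑-D⁴-period (λ x≈y → ∑-cong (λ z → δ-respʳ t (+-congʳ x≈y)) (D₄ j)) i

  n-periodʳ : ∀ i j t → n[ i , 4 + j ] t ≡ n[ i , j ] t
  n-periodʳ i j t = ∑-cong (λ x → ∑-D⁴-period (λ y≈z → δ-respʳ t (+-congˡ (-‿cong y≈z))) j) (D₄ i)

  -- Multiplying x and y by `α` moves both up one class and multiplies their difference by `α`;
  -- cancellation makes the correspondence exact.
  n-scale : ∀ i j t → n[ suc i , suc j ] (α · t) ≡ n[ i , j ] t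
  n-scale i j t = trans (cong₂ (N (α · t)) (D⁴-suc i) (D⁴-suc j))
    (trans (∑-map _ (α ·_) (D₄ i)) (∑-cong (λ x →
      trans (∑-map _ (α ·_) (D₄ j)) (∑-cong (λ y → δ-cong
        (λ eq → ·-cancelˡ α α≉0 (≈-trans eq (≈-sym (x[y-z]≈xy-xz α x y))))
        (λ eq → ≈-trans (*-congˡ eq) (x[y-z]≈xy-xz α x y))) (D₄ j))) (D₄ i)))

  -- x − y = (−y) − (−x)
  n-flip : ∀ i j t → n[ i , j ] t ≡ n[ 2 + j , 2 + i ] t
  n-flip i j t = begin
    ∑ (λ x → ∑ (λ y → δ t (x - y)) (D₄ j)) (D₄ i)
      ≡⟨ ∑-cong (λ x → ∑-cong (λ y → δ-respʳ t (≈-trans (+-comm x (- y)) (+-congˡ (≈-sym (-‿involutive x))))) (D₄ j)) (D₄ i) ⟩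
    ∑ (λ x → ∑ (λ y → δ t (- y - (- x))) (D₄ j)) (D₄ i)
      ≡⟨ ∑-swap _ (D₄ i) (D₄ j) ⟩
    ∑ (λ y → ∑ (λ x → δ t (- y - (- x))) (D₄ i)) (D₄ j)
      ≡⟨ ∑-cong (λ y → ∑-D⁴-neg (λ eq → δ-respʳ t (+-congˡ (-‿cong eq))) i) (D₄ j) ⟩
    ∑ (λ y → ∑ (λ x → δ t (- y - x)) (D₄ (2 + i))) (D₄ j)
      ≡⟨ ∑-D⁴-neg (λ eq → ∑-cong (λ x → δ-respʳ t (+-congʳ eq)) (D₄ (2 + i))) j ⟩
    ∑ (λ y → ∑ (λ x → δ t (y - x)) (D₄ (2 + i))) (D₄ (2 + j))
      ∎
    where open ≡-Reasoning

  -- These four identities bring the differences from D⁴₁ ∪ D⁴₃ to D⁴₀ ∪ D⁴₂ into the form of the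
  -- summands of `T`. They serve both `T-scale` and the differences from S₃ to S₂.
  n₁₀ : ∀ t → n[ 1 , 0 ] t ≡ n[ 2 , 3 ] t
  n₁₀ t = n-flip 1 0 t

  n₃₀ : ∀ t → n[ 3 , 0 ] t ≡ n[ 2 , 1 ] t
  n₃₀ t = trans (n-flip 3 0 t) (n-periodʳ 2 1 t)

  n₁₂ : ∀ t → n[ 1 , 2 ] t ≡ n[ 0 , 3 ] t
  n₁₂ t = trans (n-flip 1 2 t) (n-periodˡ 0 3 t)

  n₃₂ : ∀ t → n[ 3 , 2 ] t ≡ n[ 0 , 1 ] t
  n₃₂ t = trans (n-flip 3 2 t) (trans (n-periodˡ 0 5 t) (n-periodʳ 0 1 t))

  T : Carrier → ℕ
  T t = (n[ 0 , 1 ] t + n[ 2 , 3 ] t) + (n[ 0 , 3 ] t + n[ 2 , 1 ] t)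

  -- Scaling permutes the summands in a 4-cycle of index pairs, (0,1), (2,1), (2,3), (0,3): each
  -- count at `α · t` is the next one at `t`.
  T-scale : ∀ t → T (α · t) ≡ T t
  T-scale t = trans (cong₂ _+_ (cong₂ _+_ s₀₁ s₂₃) (cong₂ _+_ s₀₃ s₂₁))
    (solve 4 (λ a b c d → (a :+ b) :+ (c :+ d) := (c :+ d) :+ (b :+ a)) refl
      (n[ 2 , 1 ] t) (n[ 0 , 3 ] t) (n[ 0 , 1 ] t) (n[ 2 , 3 ] t))
    where
    open +-*-Solver
    s₀₁ : n[ 0 , 1 ] (α · t) ≡ n[ 2 , 1 ] t
    -- Index 0 is read as 4, so that both indices can be lowered by one.
    s₀₁ = trans (sym (n-periodˡ 0 1 (α · t))) (trans (n-scale 3 0 t) (n₃₀ t))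
    s₂₃ : n[ 2 , 3 ] (α · t) ≡ n[ 0 , 3 ] t
    s₂₃ = trans (n-scale 1 2 t) (n₁₂ t)
    s₀₃ : n[ 0 , 3 ] (α · t) ≡ n[ 0 , 1 ] t
    s₀₃ = trans (sym (n-periodˡ 0 3 (α · t))) (trans (n-scale 3 2 t) (n₃₂ t))
    s₂₁ : n[ 2 , 1 ] (α · t) ≡ n[ 2 , 3 ] t
    s₂₁ = trans (n-scale 1 0 t) (n₁₀ t)

  T-power : ∀ n → T (α ^ n) ≡ T 1#
  T-power zero    = refl
  T-power (suc n) = trans (T-scale (α ^ n)) (T-power n)

  T-respects : Respects T
  T-respects eq = cong₂ _+_ (cong₂ _+_ (N-respects (D₄ 0) (D₄ 1) eq) (N-respects (D₄ 2) (D₄ 3) eq))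
                            (cong₂ _+_ (N-respects (D₄ 0) (D₄ 3) eq) (N-respects (D₄ 2) (D₄ 1) eq))

  T1≤k : T 1# ≤ k
  T1≤k = *-cancelˡ-≤ (4 * k) (begin
    (4 * k) * T 1#   ≡⟨ solve 2 (λ k t → con 4 :* k :* t := k :* t :+ (k :* t :+ (k :* t :+ k :* t))) refl k (T 1#) ⟩
    k * T 1# + (k * T 1# + (k * T 1# + k * T 1#))
      ≡⟨ cong₂ _+_ (∑T 0) (cong₂ _+_ (∑T 1) (cong₂ _+_ (∑T 2) (∑T 3))) ⟨
    ∑ T (D₄ 0) + (∑ T (D₄ 1) + (∑ T (D₄ 2) + ∑ T (D₄ 3))) ≡⟨ ∑-F* T ⟨
    ∑ T F*           ≡⟨ trans (∑-+ (λ t → n[ 0 , 1 ] t + n[ 2 , 3 ] t) (λ t → n[ 0 , 3 ] t + n[ 2 , 1 ] t) F*)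
                          (cong₂ _+_ (∑-+ n[ 0 , 1 ] n[ 2 , 3 ] F*) (∑-+ n[ 0 , 3 ] n[ 2 , 1 ] F*)) ⟩
    (∑ n[ 0 , 1 ] F* + ∑ n[ 2 , 3 ] F*) + (∑ n[ 0 , 3 ] F* + ∑ n[ 2 , 1 ] F*)
      ≤⟨ +-mono-≤ (+-mono-≤ (∑n≤k² 0 1) (∑n≤k² 2 3)) (+-mono-≤ (∑n≤k² 0 3) (∑n≤k² 2 1)) ⟩
    (k * k + k * k) + (k * k + k * k)
      ≡⟨ solve 1 (λ k → (k :* k :+ k :* k) :+ (k :* k :+ k :* k) := con 4 :* k :* k) refl k ⟩
    (4 * k) * k      ∎)
    where
    open ≤-Reasoning
    open +-*-Solver
    ∑T : ∀ i → ∑ T (D₄ i) ≡ k * T 1#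
    ∑T i = trans (∑-map T _ (upTo k)) (trans (∑-cong (λ j → T-power (i + 4 * j)) (upTo k))
      (trans (∑-const (T 1#) (upTo k)) (cong (_* T 1#) (length-upTo k))))
    ∑n≤k² : ∀ i j → ∑ n[ i , j ] F* ≤ k * k
    ∑n≤k² i j = ≤-trans (∑-N (D₄ i) (D₄ j)) (≤-reflexive (cong₂ _*_ (length-D⁴ i) (length-D⁴ j)))

  T≤k : ∀ {t} → ¬ (t ≈ 0#) → T t ≤ k
  T≤k t≉0 = let i , t≈α^i = log _ t≉0 in
    ≤-trans (≤-reflexive (trans (T-respects t≈α^i) (T-power i))) T1≤k

  0s : List Carrier
  0s = List.[ 0# ]

  x-0≈x : ∀ x → x - 0# ≈ x
  x-0≈x x = ≈-trans (+-congˡ ε⁻¹≈ε) (+-identityʳ x)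

  N-0ˡ : ∀ t → N t 0s F* ≤ 1
  N-0ˡ t = ≤-trans (≤-reflexive (trans (ℕ.+-identityʳ _) (∑-cong flip F*)))
    (∑-indicator≤1 +-abelianGroup order F*-unique (- t))
    where
    flip : ∀ y → δ t (0# - y) ≡ δ y (- t)
    flip y = δ-cong
      (λ t≈0-y → ≈-sym (≈-trans (-‿cong t≈0-y) (≈-trans (⁻¹-anti-homo‿- 0# y) (x-0≈x y))))
      (λ y≈-t → ≈-sym (≈-trans (≈-sym (⁻¹-anti-homo‿- y 0#))
        (≈-trans (-‿cong (≈-trans (x-0≈x y) y≈-t)) (-‿involutive t))))

  N-0ʳ : ∀ t → N t F* 0s ≤ 1
  N-0ʳ t = ≤-trans (≤-reflexive (∑-cong (λ x → trans (ℕ.+-identityʳ _) (δ-cong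
      (λ t≈x-0 → ≈-trans (≈-sym (x-0≈x x)) (≈-sym t≈x-0))
      (λ x≈t → ≈-trans (≈-sym x≈t) (≈-sym (x-0≈x x))))) F*))
    (∑-indicator≤1 +-abelianGroup order F*-unique t)

odd⇒2h+1 : ∀ {k} → ¬ (2 ∣ k) → ∃ λ h → k ≡ 1 + 2 * h
odd⇒2h+1 {k} 2∤k with k % 2 | m%n<n k 2 | m≡m%n+[m/n]*n k 2
... | 0           | _             | eq = contradiction (divides (k / 2) eq) 2∤k
... | 1           | _             | eq = k / 2 , trans eq (cong suc (ℕ.*-comm (k / 2) 2))
... | suc (suc _) | s≤s (s≤s ()) | _

Parity↔Fin2 : Parity ↔ Fin 2
Parity↔Fin2 = mk↔ₛ′ to from (λ { 0F → refl ; 1F → refl }) (λ { 0ℙ → refl ; 1ℙ → refl })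
  where
  to : Parity → Fin 2
  to 0ℙ = 0F
  to 1ℙ = 1F
  from : Fin 2 → Parity
  from 0F = 0ℙ
  from 1F = 1ℙ

-- e and e′ are the indicators of s = 0 and s = 1 in the multiplicity of (s, t).
collect : ∀ e e′ k p₀ p₁ p₂ p₃ r₀ r₁ r₂ r₃ n₀₁ n₂₃ n₀₃ n₂₁ →
  1 * ((e * p₀ + e′ * p₂) + (e′ * p₀ + e * p₂)) +
  (1 * ((e * p₁ + e * p₃) + (e′ * p₁ + e′ * p₃)) +
  (k * ((e * r₀ + e′ * r₀) + (e′ * r₂ + e * r₂)) +
  (1 * ((e * n₀₁ + e * n₀₃) + (e′ * n₂₁ + e′ * n₂₃)) +
  (k * ((e * r₁ + e′ * r₁) + (e * r₃ + e′ * r₃)) +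
  (1 * ((e * n₂₃ + e′ * n₀₃) + (e * n₂₁ + e′ * n₀₁)) + 0)))))
  ≡ (e + e′) * ((p₀ + (p₁ + (p₂ + p₃))) + k * (r₀ + (r₁ + (r₂ + r₃))) + ((n₀₁ + n₂₃) + (n₀₃ + n₂₁)))
collect = solve 15 (λ e e′ k p₀ p₁ p₂ p₃ r₀ r₁ r₂ r₃ n₀₁ n₂₃ n₀₃ n₂₁ →
  con 1 :* ((e :* p₀ :+ e′ :* p₂) :+ (e′ :* p₀ :+ e :* p₂)) :+
  (con 1 :* ((e :* p₁ :+ e :* p₃) :+ (e′ :* p₁ :+ e′ :* p₃)) :+
  (k :* ((e :* r₀ :+ e′ :* r₀) :+ (e′ :* r₂ :+ e :* r₂)) :+
  (con 1 :* ((e :* n₀₁ :+ e :* n₀₃) :+ (e′ :* n₂₁ :+ e′ :* n₂₃)) :+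
  (k :* ((e :* r₁ :+ e′ :* r₁) :+ (e :* r₃ :+ e′ :* r₃)) :+
  (con 1 :* ((e :* n₂₃ :+ e′ :* n₀₃) :+ (e :* n₂₁ :+ e′ :* n₀₁)) :+ con 0)))))
  := (e :+ e′) :* ((p₀ :+ (p₁ :+ (p₂ :+ p₃))) :+ k :* (r₀ :+ (r₁ :+ (r₂ :+ r₃))) :+ ((n₀₁ :+ n₂₃) :+ (n₀₃ :+ n₂₁))))
  refl
  where open +-*-Solver

-- The family S in ℤ₂ × F

module Family (F : CommutativeRing c ℓ) {q : ℕ} (isField : IsFieldOfOrder F q)
              (α : CommutativeRing.Carrier F) (α-primitive : Construction.IsPrimitive F α)
              (k h : ℕ) (k≡2h+1 : k ≡ 1 + 2 * h) (q≡4k+1 : q ≡ 4 * k + 1) where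

  open Cyclotomy F isField α α-primitive k h k≡2h+1 q≡4k+1
  open Construction F
  open CommutativeRing F using (0#; setoid)
    renaming (Carrier to K; _≈_ to _≈ᶠ_; sym to ≈ᶠ-sym; _-_ to _-ᶠ_)
  open AbelianGroup ℤ₂×F using (Carrier; _-_) renaming (setoid to ℤ₂×F-setoid)
  open Membership ℤ₂×F-setoid using (_∈_)
  open Membership setoid using () renaming (_∈_ to _∈ᶠ_)
  open Disjointness ℤ₂×F-setoid using (Disjoint)
  open Disjointness setoid using () renaming (Disjoint to Disjointᶠ)
  open Uniqueness ℤ₂×F-setoid using (Unique)
  open Uniqueness setoid using () renaming (Unique to Uniqueᶠ)
  open Differences ℤ₂×F

  order₂ : HasOrder ℤ₂×F-setoid (2 * q)
  order₂ = inverse (Parity↔Fin2 ×-inverse IsFieldOfOrder.order isField)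
    (inverse Pointwise-≡↔≡ (inverse-sym *↔×))

  open FiniteGroup ℤ₂×F order₂ using (G∖0; multiplicity; _⊆ᵐ_) renaming (_≟_ to _≟₂_)

  private
    D₄ : ℕ → List K
    D₄ = D⁴ α k
    Sᵏ = S α k

  -- The projections of the blocks to F. They are already pairwise disjoint there, which settles
  -- disjointness in the product.
  support : Fin 3 → List K
  support = 0s ∷ (D₄ 0 ++ D₄ 2) ∷ (D₄ 1 ++ D₄ 3) ∷ []

  ∈-block : ∀ {z} s xs → z ∈ [ s ]× xs → proj₂ z ∈ᶠ xs
  ∈-block s xs z∈ = let x , x∈xs , z≈sx = Membershipₚ.∈-map⁻ setoid ℤ₂×F-setoid z∈ in
    Membershipₚ.∈-resp-≈ setoid (≈ᶠ-sym (proj₂ z≈sx)) x∈xs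

  ∈-blocks : ∀ {z} s xs s′ ys → z ∈ ([ s ]× xs) ++ ([ s′ ]× ys) → proj₂ z ∈ᶠ xs ++ ys
  ∈-blocks s xs s′ ys z∈ =
    [ (λ z∈xs → Membershipₚ.∈-++⁺ˡ setoid (∈-block s xs z∈xs))
    , (λ z∈ys → Membershipₚ.∈-++⁺ʳ setoid xs (∈-block s′ ys z∈ys))
    ]′ (Membershipₚ.∈-++⁻ ℤ₂×F-setoid ([ s ]× xs) z∈)

  ∈-S⇒∈-support : ∀ {z} i → z ∈ Sᵏ i → proj₂ z ∈ᶠ support i
  ∈-S⇒∈-support 0F z∈ with ∈-blocks 0ℙ 0s 1ℙ 0s z∈
  ... | Any.here eq = Any.here eq
  ... | Any.there (Any.here eq) = Any.here eq
  ∈-S⇒∈-support 1F z∈ = ∈-blocks 0ℙ (D₄ 0) 1ℙ (D₄ 2) z∈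
  ∈-S⇒∈-support 2F z∈ = ∈-blocks 0ℙ (D₄ 1) 0ℙ (D₄ 3) z∈

  Disjoint-sym : ∀ {xs ys} → Disjointᶠ xs ys → Disjointᶠ ys xs
  Disjoint-sym d (v∈ys , v∈xs) = d (v∈xs , v∈ys)

  0s-disjoint : ∀ i → Disjointᶠ 0s (D₄ i)
  0s-disjoint i (Any.here v≈0 , v∈D) = ∈-D⁴⇒≉0 i v∈D v≈0

  D₀₂#D₁₃ : Disjointᶠ (D₄ 0 ++ D₄ 2) (D₄ 1 ++ D₄ 3)
  D₀₂#D₁₃ = Disjoint-++
    (Disjoint-sym (Disjoint-++ (D⁴-disjoint 1<4 0<4 λ ()) (D⁴-disjoint 1<4 2<4 λ ())))
    (Disjoint-sym (Disjoint-++ (D⁴-disjoint 3<4 0<4 λ ()) (D⁴-disjoint 3<4 2<4 λ ())))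

  support-disjoint : ∀ i j → i ≢ j → Disjointᶠ (support i) (support j)
  support-disjoint 0F 0F i≢j = contradiction refl i≢j
  support-disjoint 1F 1F i≢j = contradiction refl i≢j
  support-disjoint 2F 2F i≢j = contradiction refl i≢j
  support-disjoint 0F 1F _   = Disjoint-++ (0s-disjoint 0) (0s-disjoint 2)
  support-disjoint 0F 2F _   = Disjoint-++ (0s-disjoint 1) (0s-disjoint 3)
  support-disjoint 1F 0F _   = Disjoint-sym (Disjoint-++ (0s-disjoint 0) (0s-disjoint 2))
  support-disjoint 2F 0F _   = Disjoint-sym (Disjoint-++ (0s-disjoint 1) (0s-disjoint 3))
  support-disjoint 1F 2F _   = D₀₂#D₁₃
  support-disjoint 2F 1F _   = Disjoint-sym D₀₂#D₁₃

  S-disjoint : ∀ i j → i ≢ j → Disjoint (Sᵏ i) (Sᵏ j)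
  S-disjoint i j i≢j (z∈Sᵢ , z∈Sⱼ) = support-disjoint i j i≢j (∈-S⇒∈-support i z∈Sᵢ , ∈-S⇒∈-support j z∈Sⱼ)

  blocks-unique : ∀ s s′ {xs ys} → Uniqueᶠ xs → Uniqueᶠ ys → Disjointᶠ xs ys →
    Unique (([ s ]× xs) ++ ([ s′ ]× ys))
  blocks-unique s s′ {xs} {ys} xs! ys! xs#ys = Uniquenessₚ.++⁺ ℤ₂×F-setoid
    (Uniquenessₚ.map⁺ setoid ℤ₂×F-setoid proj₂ xs!) (Uniquenessₚ.map⁺ setoid ℤ₂×F-setoid proj₂ ys!)
    (λ (z∈xs , z∈ys) → xs#ys (∈-block s xs z∈xs , ∈-block s′ ys z∈ys))

  S-unique : ∀ i → Unique (Sᵏ i)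
  -- Both elements project to 0, which puts this block outside `blocks-unique`; their parities tell
  -- them apart.
  S-unique 0F = ((λ ()) ∘ proj₁ All.∷ All.[]) AllPairs.∷ All.[] AllPairs.∷ AllPairs.[]
  S-unique 1F = blocks-unique 0ℙ 1ℙ (D⁴-unique 0 0<4) (D⁴-unique 2 2<4) (D⁴-disjoint 0<4 2<4 λ ())
  S-unique 2F = blocks-unique 0ℙ 0ℙ (D⁴-unique 1 1<4) (D⁴-unique 3 3<4) (D⁴-disjoint 1<4 3<4 λ ())

  length-blocks : ∀ s s′ i j → length (([ s ]× D₄ i) ++ ([ s′ ]× D₄ j)) ≡ 2 * k
  length-blocks s s′ i j = begin
    length (([ s ]× D₄ i) ++ ([ s′ ]× D₄ j))          ≡⟨ length-++ ([ s ]× D₄ i) ⟩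
    length ([ s ]× D₄ i) + length ([ s′ ]× D₄ j)      ≡⟨ cong₂ _+_ (length-map _ (D₄ i)) (length-map _ (D₄ j)) ⟩
    length (D₄ i) + length (D₄ j)                     ≡⟨ cong₂ _+_ (length-D⁴ i) (length-D⁴ j) ⟩
    k + k                                             ≡⟨ cong (k +_) (ℕ.+-identityʳ k) ⟨
    2 * k                                             ∎
    where open ≡-Reasoning

  S-size : ∀ i → length (Sᵏ i) ≡ (2 ∷ 2 * k ∷ 2 * k ∷ []) i
  S-size 0F = refl
  S-size 1F = length-blocks 0ℙ 1ℙ 0 2
  S-size 2F = length-blocks 0ℙ 0ℙ 1 3

  S-nonEmpty : ∀ i → NonZero (length (Sᵏ i))
  S-nonEmpty 0F = _
  S-nonEmpty 1F = subst NonZero (sym (S-size 1F)) (ℕ.m*n≢0 2 k)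
  S-nonEmpty 2F = subst NonZero (sym (S-size 2F)) (ℕ.m*n≢0 2 k)

  -- Multiplicities of the weighted differences of S

  M : Carrier → List Carrier → List Carrier → ℕ
  M z xs ys = ∑ (λ x → ∑ (λ y → ⟦ z ≟₂ (x - y) ⟧) ys) xs

  M-++ʳ : ∀ z xs ys zs → M z xs (ys ++ zs) ≡ M z xs ys + M z xs zs
  M-++ʳ z xs ys zs = trans (∑-cong (λ x → ∑-++ _ ys zs) xs)
    (∑-+ (λ x → ∑ (λ y → ⟦ z ≟₂ (x - y) ⟧) ys) (λ x → ∑ (λ y → ⟦ z ≟₂ (x - y) ⟧) zs) xs)

  -- Subtraction in ℤ₂ is addition, so `a +ℙ b` is the parity of a difference.
  χ : Parity → Parity → Parity → ℕ
  χ s a b = ⟦ s ℙ.≟ (a +ℙ b) ⟧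

  M-block : ∀ s t a b xs ys → M (s , t) ([ a ]× xs) ([ b ]× ys) ≡ χ s a b * N t xs ys
  M-block s t a b xs ys = begin
    M (s , t) ([ a ]× xs) ([ b ]× ys)
      ≡⟨ ∑-map _ (a ,_) xs ⟩
    ∑ (λ x → ∑ (λ z → ⟦ (s , t) ≟₂ ((a , x) - z) ⟧) ([ b ]× ys)) xs
      ≡⟨ ∑-cong (λ x → trans (∑-map _ (b ,_) ys) (∑-cong (λ y → ⟦⟧-× {P? = (s , t) ≟₂ ((a , x) - (b , y))}
           {s ℙ.≟ (a +ℙ b)} {t ≟ (x -ᶠ y)} (λ eq → eq) _,_) ys)) xs ⟩
    ∑ (λ x → ∑ (λ y → χ s a b * δ t (x -ᶠ y)) ys) xs
      ≡⟨ ∑-cong (λ x → ∑-* (χ s a b) (λ y → δ t (x -ᶠ y)) ys) xs ⟩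
    ∑ (λ x → χ s a b * ∑ (λ y → δ t (x -ᶠ y)) ys) xs
      ≡⟨ ∑-* (χ s a b) (λ x → ∑ (λ y → δ t (x -ᶠ y)) ys) xs ⟩
    χ s a b * N t xs ys ∎
    where open ≡-Reasoning

  M-blocks : ∀ s t a b a′ b′ xs ys us vs →
    M (s , t) (([ a ]× xs) ++ ([ b ]× ys)) (([ a′ ]× us) ++ ([ b′ ]× vs)) ≡
    (χ s a a′ * N t xs us + χ s a b′ * N t xs vs) + (χ s b a′ * N t ys us + χ s b b′ * N t ys vs)
  M-blocks s t a b a′ b′ xs ys us vs = trans (∑-++ _ ([ a ]× xs) ([ b ]× ys))
    (cong₂ _+_ (row a xs) (row b ys))
    where
    row : ∀ a xs → M (s , t) ([ a ]× xs) (([ a′ ]× us) ++ ([ b′ ]× vs)) ≡ χ s a a′ * N t xs us + χ s a b′ * N t xs vs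
    row a xs = trans (M-++ʳ (s , t) ([ a ]× xs) ([ a′ ]× us) ([ b′ ]× vs))
      (cong₂ _+_ (M-block s t a a′ xs us) (M-block s t a b′ xs vs))

  M-⊠ : ∀ w z xs ys → M z xs (w ⊠ ys) ≡ w * M z xs ys
  M-⊠ w z xs ys = trans (∑-cong (λ x → ∑-⊠ (λ y → ⟦ z ≟₂ (x - y) ⟧) w ys) xs)
    (∑-* w (λ x → ∑ (λ y → ⟦ z ≟₂ (x - y) ⟧) ys) xs)

  N-F*ʳ : ∀ t → N t 0s F* ≡ N t 0s (D₄ 0) + (N t 0s (D₄ 1) + (N t 0s (D₄ 2) + N t 0s (D₄ 3)))
  N-F*ʳ t = trans (N-++ʳ t 0s (D₄ 0) _) (cong (N t 0s (D₄ 0) +_)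
    (trans (N-++ʳ t 0s (D₄ 1) _) (cong (N t 0s (D₄ 1) +_) (N-++ʳ t 0s (D₄ 2) (D₄ 3)))))

  -- The factor `k` marks the pairs whose subtracted block is S₁, the only block with weight other
  -- than 2k / 2k = 1.
  weightedCount : Parity → K → ℕ
  weightedCount s t =
    1 * M (s , t) (Sᵏ 0F) (Sᵏ 1F) + (1 * M (s , t) (Sᵏ 0F) (Sᵏ 2F) + (k * M (s , t) (Sᵏ 1F) (Sᵏ 0F) +
    (1 * M (s , t) (Sᵏ 1F) (Sᵏ 2F) + (k * M (s , t) (Sᵏ 2F) (Sᵏ 0F) + (1 * M (s , t) (Sᵏ 2F) (Sᵏ 1F) + 0)))))

  multiplicity-externalDifferences : ∀ s t →
    multiplicity (s , t) (externalDifferences Sᵏ S-nonEmpty) ≡ weightedCount s t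
  multiplicity-externalDifferences s t = begin
    multiplicity z (externalDifferences Sᵏ S-nonEmpty)          ≡⟨ multiplicity≡∑ ℤ₂×F order₂ z (externalDifferences Sᵏ S-nonEmpty) ⟩
    ∑ (λ y → ⟦ z ≟₂ y ⟧) (externalDifferences Sᵏ S-nonEmpty)    ≡⟨ ∑-externalDifferences ℤ₂×F k Sᵏ S-nonEmpty S-size (λ y → ⟦ z ≟₂ y ⟧) ⟩
    _ ≡⟨ cong₂ _+_ (term 0F 1F) (cong₂ _+_ (term 0F 2F) (cong₂ _+_ (term 1F 0F)
         (cong₂ _+_ (term 1F 2F) (cong₂ _+_ (term 2F 0F) (cong (_+ 0) (term 2F 1F)))))) ⟩
    weightedCount s t                                           ∎
    where
    open ≡-Reasoning
    z = s , t
    w : Fin 3 → ℕ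
    w j = proj₁ (weights ℤ₂×F k Sᵏ S-nonEmpty S-size j)
    term : ∀ i j → ∑ (λ y → ⟦ z ≟₂ y ⟧) (D (Sᵏ i) (weighted Sᵏ S-nonEmpty j)) ≡ w j * M z (Sᵏ i) (Sᵏ j)
    term i j = trans (∑-cartesianProductWith _ _-_ (Sᵏ i) (weighted Sᵏ S-nonEmpty j))
      (trans (cong (M z (Sᵏ i)) (weighted-by ℤ₂×F k Sᵏ S-nonEmpty S-size j (w j)
                 (proj₂ (weights ℤ₂×F k Sᵏ S-nonEmpty S-size j))))
        (M-⊠ (w j) z (Sᵏ i) (Sᵏ j)))

  -- The right side is free of `s`. For s = 0, S₂ minus S₃ gives n[0,1] + n[0,3], and S₃ minus S₂
  -- gives n[2,3] + n[2,1] after flipping; for s = 1 the two sums change places. The block S₁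
  -- contains 0 with both parities, so its share is also the same for either `s`.
  weightedCount≡ : ∀ s t → weightedCount s t ≡ N t 0s F* + k * N t F* 0s + T t
  weightedCount≡ s t = begin
    weightedCount s t
      ≡⟨ cong₂ _+_ (cong (1 *_) (M-blocks s t 0ℙ 1ℙ 0ℙ 1ℙ 0s 0s (D₄ 0) (D₄ 2)))
        (cong₂ _+_ (cong (1 *_) (M-blocks s t 0ℙ 1ℙ 0ℙ 0ℙ 0s 0s (D₄ 1) (D₄ 3)))
        (cong₂ _+_ (cong (k *_) (M-blocks s t 0ℙ 1ℙ 0ℙ 1ℙ (D₄ 0) (D₄ 2) 0s 0s))
        (cong₂ _+_ (cong (1 *_) (M-blocks s t 0ℙ 1ℙ 0ℙ 0ℙ (D₄ 0) (D₄ 2) (D₄ 1) (D₄ 3)))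
        (cong₂ _+_ (cong (k *_) (M-blocks s t 0ℙ 0ℙ 0ℙ 1ℙ (D₄ 1) (D₄ 3) 0s 0s))
        (cong (λ m → 1 * m + 0) (trans (M-blocks s t 0ℙ 0ℙ 0ℙ 1ℙ (D₄ 1) (D₄ 3) (D₄ 0) (D₄ 2))
          (cong₂ _+_ (cong₂ _+_ (cong (χ s 0ℙ 0ℙ *_) (n₁₀ t)) (cong (χ s 0ℙ 1ℙ *_) (n₁₂ t)))
                     (cong₂ _+_ (cong (χ s 0ℙ 0ℙ *_) (n₃₀ t)) (cong (χ s 0ℙ 1ℙ *_) (n₃₂ t)))))))))) ⟩
    -- Sums of closed parities evaluate, so only the indicators of s = 0 and s = 1 remain, and
    -- exactly one of them is 1.
    _ ≡⟨ collect (χ s 0ℙ 0ℙ) (χ s 0ℙ 1ℙ) k (N t 0s (D₄ 0)) (N t 0s (D₄ 1)) (N t 0s (D₄ 2)) (N t 0s (D₄ 3))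
           (N t (D₄ 0) 0s) (N t (D₄ 1) 0s) (N t (D₄ 2) 0s) (N t (D₄ 3) 0s)
           (n[ 0 , 1 ] t) (n[ 2 , 3 ] t) (n[ 0 , 3 ] t) (n[ 2 , 1 ] t) ⟩
    (χ s 0ℙ 0ℙ + χ s 0ℙ 1ℙ) * (P + k * R + T t)
      ≡⟨ cong (_* (P + k * R + T t)) (one-parity s) ⟩
    1 * (P + k * R + T t)
      ≡⟨ ℕ.*-identityˡ (P + k * R + T t) ⟩
    P + k * R + T t
      ≡⟨ cong₂ (λ x y → x + k * y + T t) (N-F*ʳ t) (∑-F* _) ⟨
    N t 0s F* + k * N t F* 0s + T t ∎
    where
    open ≡-Reasoning
    P R : ℕ
    P = N t 0s (D₄ 0) + (N t 0s (D₄ 1) + (N t 0s (D₄ 2) + N t 0s (D₄ 3)))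
    R = N t (D₄ 0) 0s + (N t (D₄ 1) 0s + (N t (D₄ 2) 0s + N t (D₄ 3) 0s))
    one-parity : ∀ s → χ s 0ℙ 0ℙ + χ s 0ℙ 1ℙ ≡ 1
    one-parity 0ℙ = refl
    one-parity 1ℙ = refl

  -- Distinct blocks have disjoint projections to F, so no difference has second coordinate 0. This
  -- covers (0, 0), which `G∖0` omits, together with (1, 0).
  weightedCount-zero : ∀ s {t} → t ≈ᶠ 0# → weightedCount s t ≡ 0
  weightedCount-zero s {t} t≈0 = begin
    weightedCount s t                 ≡⟨ weightedCount≡ s t ⟩
    N t 0s F* + k * N t F* 0s + T t   ≡⟨ cong₂ _+_ (cong₂ (λ x y → x + k * y)
                                           (N-disjoint t≈0 0s#F*) (N-disjoint t≈0 (Disjoint-sym 0s#F*))) T≡0 ⟩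
    0 + k * 0 + 0                     ≡⟨ trans (ℕ.+-identityʳ (k * 0)) (*-zeroʳ k) ⟩
    0                                 ∎
    where
    open ≡-Reasoning
    0s#F* : Disjointᶠ 0s F*
    0s#F* = Disjoint-++ (0s-disjoint 0) (Disjoint-++ (0s-disjoint 1) (Disjoint-++ (0s-disjoint 2) (0s-disjoint 3)))
    T≡0 : T t ≡ 0
    T≡0 = cong₂ _+_
      (cong₂ _+_ (N-disjoint t≈0 (D⁴-disjoint 0<4 1<4 λ ())) (N-disjoint t≈0 (D⁴-disjoint 2<4 3<4 λ ())))
      (cong₂ _+_ (N-disjoint t≈0 (D⁴-disjoint 0<4 3<4 λ ())) (N-disjoint t≈0 (D⁴-disjoint 2<4 1<4 λ ())))

  weightedCount-nonzero : ∀ s {t} → ¬ (t ≈ᶠ 0#) → weightedCount s t ≤ 2 * k + 1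
  weightedCount-nonzero s {t} t≉0 = begin
    weightedCount s t                 ≡⟨ weightedCount≡ s t ⟩
    N t 0s F* + k * N t F* 0s + T t   ≤⟨ +-mono-≤ (+-mono-≤ (N-0ˡ t) (*-monoʳ-≤ k (N-0ʳ t))) (T≤k t≉0) ⟩
    1 + k * 1 + k                     ≡⟨ solve 1 (λ k → con 1 :+ k :* con 1 :+ k := con 2 :* k :+ con 1) refl k ⟩
    2 * k + 1                         ∎
    where
    open ≤-Reasoning
    open +-*-Solver

  bounded : externalDifferences Sᵏ S-nonEmpty ⊆ᵐ (2 * k + 1) ⊠ G∖0
  bounded z@(s , t) with t ≟ 0#
  ... | yes t≈0 = ≤-trans (≤-reflexive (trans (multiplicity-externalDifferences s t) (weightedCount-zero s t≈0))) z≤n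
  ... | no  t≉0 = ≤-trans
    (≤-trans (≤-reflexive (multiplicity-externalDifferences s t)) (weightedCount-nonzero s t≉0))
    (multiplicity-⊠-G∖0 ℤ₂×F order₂ (2 * k + 1) (t≉0 ∘ proj₂))

  isOptimalBSWEDF : IsOptimalBSWEDF ℤ₂×F (2 * q) 3 (2 ∷ 2 * k ∷ 2 * k ∷ []) (4 * k + 2) (2 * k + 1) Sᵏ
  isOptimalBSWEDF = record
    { isBSWEDF = record
      { order    = order₂
      ; unique   = S-unique
      ; disjoint = S-disjoint
      ; nonEmpty = S-nonEmpty
      ; size     = S-size
      ; total    = solve 1 (λ k → con 4 :* k :+ con 2 := con 2 :+ (con 2 :* k :+ (con 2 :* k :+ con 0))) refl k
      ; positive = subst NonZero (ℕ.+-comm 1 (2 * k)) _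
      ; bound    = bounded
      ; smallest = λ μ _ → lower-bound ℤ₂×F Sᵏ S-nonEmpty S-size order₂ μ
      }
    ; optimal = λ H a′ l′ C C-isBSWEDF → let open IsBSWEDF C-isBSWEDF in
        lower-bound H C nonEmpty size order l′ bound
    }
    where
    open +-*-Solver
    -- Taken over all groups and families with these sizes, so that one statement yields both the
    -- minimality of λ for S and the comparison with every other family.
    lower-bound : ∀ {c′ ℓ′} (H : AbelianGroup c′ ℓ′) (C : Vector (List (AbelianGroup.Carrier H)) 3)
      .(ne : ∀ i → NonZero (length (C i))) → (∀ i → length (C i) ≡ (2 ∷ 2 * k ∷ 2 * k ∷ []) i) →
      (order : HasOrder (AbelianGroup.setoid H) (2 * q)) → ∀ μ →
      FiniteGroup._⊆ᵐ_ H order (Differences.externalDifferences H C ne) (μ ⊠ FiniteGroup.G∖0 H order) →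
      2 * k + 1 ≤ μ
    lower-bound H C ne size = counting-bound H k C ne size (>-nonZero⁻¹ k) q≡4k+1

theorem3 : ∀ {c ℓ} (q k : ℕ) → q ≡ 4 * k + 1 → PrimePower q → ¬ (2 ∣ k) →
    (F : CommutativeRing c ℓ) → IsFieldOfOrder F q →
    (α : CommutativeRing.Carrier F) → Construction.IsPrimitive F α →
    IsOptimalBSWEDF (Construction.ℤ₂×F F) (2 * q) 3 (2 ∷ 2 * k ∷ 2 * k ∷ [])
    (4 * k + 2) (2 * k + 1) (Construction.S F α k)
theorem3 q k q≡4k+1 _ 2∤k F isField α α-primitive =
  let h , k≡2h+1 = odd⇒2h+1 2∤k in
  Family.isOptimalBSWEDF F isField α α-primitive k h k≡2h+1 q≡4k+1
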